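{- There exists a binary oracle $O\subseteq\{0,1\}^*$ such that $\mathsf{NP}^O \nsubseteq \mathsf{P}\mathbb{R}^O$.
   Context: **Real Turing machine.** A real Turing machine $M=(\Gamma_{\mathrm{bin}},\Gamma_{\mathrm{real}},Q,\delta)$ has a binary tape with alphabet $\Gamma_{\mathrm{bin}}=\{0,1,\square,\rhd\}$ and a real tape with alphabet $\Gamma_{\mathrm{real}}=\mathbb{R}\cup\{\square,\rhd\}$ ($\square$ is blank, $\rhd$ is the start symbol); the cells of each tape are indexed by $\mathbb{N}$. The binary tape has one head; the real tape has a write head $h$ and two reading heads $i,j$. The finite state set is $Q=\{1,\dots,q\}$, with start state $1$ and halting state $q$. The set $\mathrm{op}$ of operations on the real tape (where $x_h,x_i,x_j$ are the contents of the cells at the heads) is: idle; $x_h\leftarrow x_i+x_j$; $x_h\leftarrow x_i-x_j$; $x_h\leftarrow x_i\cdot x_j$; $x_h\leftarrow x_i/x_j$; $x_h\leftarrow c$ for $c\in\{0,1,\square,\rhd\}$; $x_h\leftarrow x_i$. No other real constants are available. The transition function is $\delta:Q\times\Gamma_{\mathrm{bin}}\times\{+,0,-\}\to Q\times\Gamma_{\mathrm{bin}}\times\mathrm{op}\times\{\leftarrow,\circ,\rightarrow\}^4$: it reads the state, the symbol at the binary head and the sign of $x_i$ (the sign of $\square,\rhd$ is $0$), and gives the new state, the binary symbol to write, the real operation and the moves of the four heads (a head in the leftmost cell cannot move left and stays put). Initially each tape contains $\rhd$ in its first cell followed by the binary (respectively real) input and then blanks, with all heads at the left end. The output upon halting is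 the content to the left of $h$ on the real tape, ignoring $\square$ and $\rhd$; $M(x)=1$ means that the output is $1$. The input size is the number of binary and real input symbols; running time is the number of steps until halting. **Oracles.** A binary oracle is a set $O\subseteq\{0,1\}^*$. An oracle machine $M^O$ has an additional one-headed oracle tape (alphabet $\Gamma_{\mathrm{bin}}$) to which it can copy symbols from another tape or write $\square$ or $\rhd$; the string on it (ignoring $\square,\rhd$) is the query $y$, and the transition function additionally receives in one step the answer to "$y\in O$?". **Classes.** $\mathsf{P}\mathbb{R}^O$ is the class of binary languages $L\subseteq\{0,1\}^*$ decided in polynomial time by a real Turing machine with oracle $O$ (with binary input $x$ and no real input). $\mathsf{NP}^O$ is the usual class $\mathsf{NP}$ relative to $O$. -}

module Defs where

open import Data.Bool using (Bool; true; false)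
open import Data.Empty using (⊥-elim)
open import Data.Fin using (Fin; zero; fromℕ)
open import Data.List using (List; []; _∷_; foldr; length; map; mapMaybe; take)
open import Data.List.Membership.Propositional using () renaming (_∈_ to _∈ˡ_)
open import Data.List.Relation.Binary.Pointwise using (Pointwise)
open import Data.Maybe using (Maybe; just; nothing)
open import Data.Nat as ℕ using (ℕ; zero; suc; pred; _⊔_)
import Data.Nat.Properties as ℕ
open import Data.Product using (∃-syntax; _×_; _,_)
open import Data.Rational as ℚ using (ℚ; 0ℚ; 1ℚ)
import Data.Rational.Properties as ℚ
open import Data.Rational.Solver using (module +-*-Solver)
open import Data.Sum using (_⊎_; inj₁; inj₂)
open import Function using (_⇔_)
open import Level using (0ℓ)
open import Relation.Binary.PropositionalEquality
open import Relation.Nullary using (yes; no)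
open import Relation.Unary using (Pred; _∈_; _∉_)

-- Real numbers: Cauchy sequences of rationals, with the equality _≃_.

IsCauchy : (ℕ → ℚ) → Set
IsCauchy s = ∀ ε → 0ℚ ℚ.< ε →
  ∃[ N ] (∀ m n → N ℕ.≤ m → N ℕ.≤ n → ℚ.∣ s m ℚ.- s n ∣ ℚ.≤ ε)

record ℝ : Set where
  constructor mkℝ
  field
    seq    : ℕ → ℚ
    cauchy : IsCauchy seq

open ℝ public

infix 4 _≃_ _<_ _#_

_≃_ : ℝ → ℝ → Set
x ≃ y = ∀ ε → 0ℚ ℚ.< ε →
  ∃[ N ] (∀ n → N ℕ.≤ n → ℚ.∣ seq x n ℚ.- seq y n ∣ ℚ.≤ ε)

_<_ : ℝ → ℝ → Set
x < y = ∃[ ε ] 0ℚ ℚ.< ε ×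
  ∃[ N ] (∀ n → N ℕ.≤ n → seq x n ℚ.+ ε ℚ.≤ seq y n)

_#_ : ℝ → ℝ → Set
x # y = x < y ⊎ y < x

private
  open +-*-Solver using (solve; _:=_; _:+_; _:-_; _:*_; :-_)

  scale : ∀ K ε → 0ℚ ℚ.< K → 0ℚ ℚ.< ε → ∃[ η ] 0ℚ ℚ.< η × K ℚ.* η ≡ ε
  scale K ε 0<K 0<ε = ε ℚ.* r , 0<εr , eq
    where
    instance
      K⁺ : ℚ.Positive K
      K⁺ = ℚ.positive 0<K
      K≢0 : ℚ.NonZero K
      K≢0 = ℚ.pos⇒nonZero K
    r : ℚ
    r = ℚ.1/ K
    instance
      r⁺ : ℚ.Positive r
      r⁺ = ℚ.1/pos⇒pos K
    0<εr : 0ℚ ℚ.< ε ℚ.* r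
    0<εr = subst (ℚ._< ε ℚ.* r) (ℚ.*-zeroˡ r) (ℚ.*-monoˡ-<-pos r 0<ε)
    rearrange : ∀ k e s → k ℚ.* (e ℚ.* s) ≡ e ℚ.* (k ℚ.* s)
    rearrange = solve 3 (λ k e s → k :* (e :* s) := e :* (k :* s)) refl
    eq : K ℚ.* (ε ℚ.* r) ≡ ε
    eq = trans (rearrange K ε r)
      (trans (cong (ε ℚ.*_) (ℚ.*-inverseʳ K)) (ℚ.*-identityʳ ε))

  *-mono-≤ : ∀ {a b c d} → 0ℚ ℚ.≤ c → 0ℚ ℚ.≤ b →
             a ℚ.≤ b → c ℚ.≤ d → a ℚ.* c ℚ.≤ b ℚ.* d
  *-mono-≤ {a} {b} {c} {d} 0≤c 0≤b a≤b c≤d = ℚ.≤-trans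
    (ℚ.*-monoʳ-≤-nonNeg c {{ℚ.nonNegative 0≤c}} a≤b)
    (ℚ.*-monoˡ-≤-nonNeg b {{ℚ.nonNegative 0≤b}} c≤d)

  0<1 : 0ℚ ℚ.< 1ℚ
  0<1 = ℚ.positive⁻¹ 1ℚ

  ∣∣-bound : ∀ a c → ℚ.∣ a ℚ.- c ∣ ℚ.≤ 1ℚ → ℚ.∣ a ∣ ℚ.≤ 1ℚ ℚ.+ ℚ.∣ c ∣
  ∣∣-bound a c close = begin
    ℚ.∣ a ∣                     ≡⟨ cong ℚ.∣_∣ (split a c) ⟩
    ℚ.∣ (a ℚ.- c) ℚ.+ c ∣       ≤⟨ ℚ.∣p+q∣≤∣p∣+∣q∣ (a ℚ.- c) c ⟩
    ℚ.∣ a ℚ.- c ∣ ℚ.+ ℚ.∣ c ∣   ≤⟨ ℚ.+-monoˡ-≤ ℚ.∣ c ∣ close ⟩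
    1ℚ ℚ.+ ℚ.∣ c ∣              ∎
    where
    open ℚ.≤-Reasoning
    split : ∀ s t → s ≡ (s ℚ.- t) ℚ.+ t
    split = solve 2 (λ s t → s := (s :- t) :+ t) refl

  +-close : ∀ a b a′ b′ η → ℚ.∣ a ℚ.- a′ ∣ ℚ.≤ η → ℚ.∣ b ℚ.- b′ ∣ ℚ.≤ η →
            ℚ.∣ (a ℚ.+ b) ℚ.- (a′ ℚ.+ b′) ∣ ℚ.≤ (1ℚ ℚ.+ 1ℚ) ℚ.* η
  +-close a b a′ b′ η close-a close-b = begin
    ℚ.∣ (a ℚ.+ b) ℚ.- (a′ ℚ.+ b′) ∣      ≡⟨ cong ℚ.∣_∣ (regroup a b a′ b′) ⟩
    ℚ.∣ (a ℚ.- a′) ℚ.+ (b ℚ.- b′) ∣      ≤⟨ ℚ.∣p+q∣≤∣p∣+∣q∣ (a ℚ.- a′) (b ℚ.- b′) ⟩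
    ℚ.∣ a ℚ.- a′ ∣ ℚ.+ ℚ.∣ b ℚ.- b′ ∣    ≤⟨ ℚ.+-mono-≤ close-a close-b ⟩
    η ℚ.+ η                              ≡⟨ sym (cong₂ ℚ._+_ (ℚ.*-identityˡ η) (ℚ.*-identityˡ η)) ⟩
    1ℚ ℚ.* η ℚ.+ 1ℚ ℚ.* η                ≡⟨ sym (ℚ.*-distribʳ-+ η 1ℚ 1ℚ) ⟩
    (1ℚ ℚ.+ 1ℚ) ℚ.* η                    ∎
    where
    open ℚ.≤-Reasoning
    regroup : ∀ a b a′ b′ → (a ℚ.+ b) ℚ.- (a′ ℚ.+ b′) ≡ (a ℚ.- a′) ℚ.+ (b ℚ.- b′)
    regroup = solve 4 (λ a b a′ b′ →
      (a :+ b) :- (a′ :+ b′) := (a :- a′) :+ (b :- b′)) refl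

  neg-close : ∀ a a′ → ℚ.∣ a ℚ.- a′ ∣ ≡ ℚ.∣ (ℚ.- a′) ℚ.- (ℚ.- a) ∣
  neg-close a a′ = cong ℚ.∣_∣ (regroup a a′)
    where
    regroup : ∀ a b → a ℚ.- b ≡ (ℚ.- b) ℚ.- (ℚ.- a)
    regroup = solve 2 (λ a b → a :- b := (:- b) :- (:- a)) refl

  *-close : ∀ a b a′ b′ A B η → 0ℚ ℚ.< A → 0ℚ ℚ.< B →
            ℚ.∣ a ∣ ℚ.≤ A → ℚ.∣ b′ ∣ ℚ.≤ B →
            ℚ.∣ a ℚ.- a′ ∣ ℚ.≤ η → ℚ.∣ b ℚ.- b′ ∣ ℚ.≤ η →
            ℚ.∣ a ℚ.* b ℚ.- a′ ℚ.* b′ ∣ ℚ.≤ (A ℚ.+ B) ℚ.* η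
  *-close a b a′ b′ A B η 0<A 0<B a≤A b′≤B close-a close-b = begin
    ℚ.∣ a ℚ.* b ℚ.- a′ ℚ.* b′ ∣
      ≡⟨ cong ℚ.∣_∣ (regroup a b a′ b′) ⟩
    ℚ.∣ a ℚ.* (b ℚ.- b′) ℚ.+ b′ ℚ.* (a ℚ.- a′) ∣
      ≤⟨ ℚ.∣p+q∣≤∣p∣+∣q∣ (a ℚ.* (b ℚ.- b′)) (b′ ℚ.* (a ℚ.- a′)) ⟩
    ℚ.∣ a ℚ.* (b ℚ.- b′) ∣ ℚ.+ ℚ.∣ b′ ℚ.* (a ℚ.- a′) ∣
      ≡⟨ cong₂ ℚ._+_ (ℚ.∣p*q∣≡∣p∣*∣q∣ a (b ℚ.- b′)) (ℚ.∣p*q∣≡∣p∣*∣q∣ b′ (a ℚ.- a′)) ⟩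
    ℚ.∣ a ∣ ℚ.* ℚ.∣ b ℚ.- b′ ∣ ℚ.+ ℚ.∣ b′ ∣ ℚ.* ℚ.∣ a ℚ.- a′ ∣
      ≤⟨ ℚ.+-mono-≤
           (*-mono-≤ (ℚ.0≤∣p∣ (b ℚ.- b′)) (ℚ.<⇒≤ 0<A) a≤A close-b)
           (*-mono-≤ (ℚ.0≤∣p∣ (a ℚ.- a′)) (ℚ.<⇒≤ 0<B) b′≤B close-a) ⟩
    A ℚ.* η ℚ.+ B ℚ.* η
      ≡⟨ sym (ℚ.*-distribʳ-+ η A B) ⟩
    (A ℚ.+ B) ℚ.* η ∎
    where
    open ℚ.≤-Reasoning
    regroup : ∀ a b a′ b′ →
      a ℚ.* b ℚ.- a′ ℚ.* b′ ≡ a ℚ.* (b ℚ.- b′) ℚ.+ b′ ℚ.* (a ℚ.- a′)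
    regroup = solve 4 (λ a b a′ b′ →
      a :* b :- a′ :* b′ := a :* (b :- b′) :+ b′ :* (a :- a′)) refl

  bounded : (x : ℝ) → ∃[ B ] 0ℚ ℚ.< B ×
            ∃[ N ] (∀ n → N ℕ.≤ n → ℚ.∣ seq x n ∣ ℚ.≤ B)
  bounded x =
    let N , close = cauchy x 1ℚ 0<1
    in 1ℚ ℚ.+ ℚ.∣ seq x N ∣ , ℚ.+-mono-<-≤ 0<1 (ℚ.0≤∣p∣ (seq x N)) ,
       N , λ n N≤n → ∣∣-bound (seq x n) (seq x N) (close n N N≤n ℕ.≤-refl)

fromℚ : ℚ → ℝ
fromℚ q = mkℝ (λ _ → q) λ ε 0<ε →
  0 , λ _ _ _ _ → subst (λ t → ℚ.∣ t ∣ ℚ.≤ ε) (sym (ℚ.+-inverseʳ q)) (ℚ.<⇒≤ 0<ε)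

0ℝ 1ℝ : ℝ
0ℝ = fromℚ 0ℚ
1ℝ = fromℚ 1ℚ

infixl 6 _+_ _-_
infixl 7 _*_
infix  8 -_

_+_ : ℝ → ℝ → ℝ
x + y = mkℝ (λ n → seq x n ℚ.+ seq y n) λ ε 0<ε →
  let η , 0<η , 2η≡ε = scale (1ℚ ℚ.+ 1ℚ) ε (ℚ.+-mono-< 0<1 0<1) 0<ε
      M , close-x = cauchy x η 0<η
      N , close-y = cauchy y η 0<η
  in M ⊔ N , λ m n p q → ℚ.≤-trans
       (+-close (seq x m) (seq y m) (seq x n) (seq y n) η
         (close-x m n (ℕ.m⊔n≤o⇒m≤o M N p) (ℕ.m⊔n≤o⇒m≤o M N q))
         (close-y m n (ℕ.m⊔n≤o⇒n≤o M N p) (ℕ.m⊔n≤o⇒n≤o M N q)))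
       (ℚ.≤-reflexive 2η≡ε)

-_ : ℝ → ℝ
- x = mkℝ (λ n → ℚ.- seq x n) λ ε 0<ε →
  let N , close = cauchy x ε 0<ε
  in N , λ m n p q → ℚ.≤-trans
       (ℚ.≤-reflexive (sym (neg-close (seq x n) (seq x m)))) (close n m q p)

_-_ : ℝ → ℝ → ℝ
x - y = x + (- y)

_*_ : ℝ → ℝ → ℝ
x * y = mkℝ (λ n → seq x n ℚ.* seq y n) λ ε 0<ε →
  let A , 0<A , K , x≤A = bounded x
      B , 0<B , L , y≤B = bounded y
      η , 0<η , [A+B]η≡ε = scale (A ℚ.+ B) ε (ℚ.+-mono-< 0<A 0<B) 0<ε
      M , close-x = cauchy x η 0<η
      N , close-y = cauchy y η 0<η
  in (K ⊔ L) ⊔ (M ⊔ N) , λ m n p q →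
    let KL≤m = ℕ.m⊔n≤o⇒m≤o (K ⊔ L) (M ⊔ N) p
        KL≤n = ℕ.m⊔n≤o⇒m≤o (K ⊔ L) (M ⊔ N) q
        MN≤m = ℕ.m⊔n≤o⇒n≤o (K ⊔ L) (M ⊔ N) p
        MN≤n = ℕ.m⊔n≤o⇒n≤o (K ⊔ L) (M ⊔ N) q
    in ℚ.≤-trans
         (*-close (seq x m) (seq y m) (seq x n) (seq y n) A B η 0<A 0<B
           (x≤A m (ℕ.m⊔n≤o⇒m≤o K L KL≤m))
           (y≤B n (ℕ.m⊔n≤o⇒n≤o K L KL≤n))
           (close-x m n (ℕ.m⊔n≤o⇒m≤o M N MN≤m) (ℕ.m⊔n≤o⇒m≤o M N MN≤n))
           (close-y m n (ℕ.m⊔n≤o⇒n≤o M N MN≤m) (ℕ.m⊔n≤o⇒n≤o M N MN≤n)))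
         (ℚ.≤-reflexive [A+B]η≡ε)

-- Total on ℚ, so that the inverse of a real can be taken pointwise: a sequence
-- representing a nonzero real has only finitely many zero terms.
invℚ : ℚ → ℚ
invℚ q with q ℚ.≟ 0ℚ
... | yes _  = 0ℚ
... | no q≢0 = ℚ.1/_ q {{ℚ.≢-nonZero q≢0}}

private
  invℚ-inverseʳ : ∀ q → q ≢ 0ℚ → q ℚ.* invℚ q ≡ 1ℚ
  invℚ-inverseʳ q q≢0 with q ℚ.≟ 0ℚ
  ... | yes q≡0 = ⊥-elim (q≢0 q≡0)
  ... | no q≢0′ = ℚ.*-inverseʳ q {{ℚ.≢-nonZero q≢0′}}

  p≤∣p∣ : ∀ p → p ℚ.≤ ℚ.∣ p ∣
  p≤∣p∣ p with ℚ.≤-total 0ℚ p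
  ... | inj₁ 0≤p = ℚ.≤-reflexive (sym (ℚ.0≤p⇒∣p∣≡p 0≤p))
  ... | inj₂ p≤0 = ℚ.≤-trans p≤0 (ℚ.0≤∣p∣ p)

  below : ∀ a δ → a ℚ.+ δ ℚ.≤ 0ℚ → δ ℚ.≤ ℚ.∣ a ∣
  below a δ a+δ≤0 = begin
    δ                        ≡⟨ split δ a ⟩
    (ℚ.- a) ℚ.+ (a ℚ.+ δ)    ≤⟨ ℚ.+-monoʳ-≤ (ℚ.- a) a+δ≤0 ⟩
    (ℚ.- a) ℚ.+ 0ℚ           ≡⟨ ℚ.+-identityʳ (ℚ.- a) ⟩
    ℚ.- a                    ≤⟨ p≤∣p∣ (ℚ.- a) ⟩
    ℚ.∣ ℚ.- a ∣              ≡⟨ ℚ.∣-p∣≡∣p∣ a ⟩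
    ℚ.∣ a ∣                  ∎
    where
    open ℚ.≤-Reasoning
    split : ∀ d a → d ≡ (ℚ.- a) ℚ.+ (a ℚ.+ d)
    split = solve 2 (λ d a → d := (:- a) :+ (a :+ d)) refl

  above : ∀ a δ → 0ℚ ℚ.+ δ ℚ.≤ a → δ ℚ.≤ ℚ.∣ a ∣
  above a δ δ≤a = ℚ.≤-trans (ℚ.≤-reflexive (sym (ℚ.+-identityˡ δ)))
    (ℚ.≤-trans δ≤a (p≤∣p∣ a))

  awayFromZero : ∀ x → x # 0ℝ →
    ∃[ δ ] 0ℚ ℚ.< δ × ∃[ N ] (∀ n → N ℕ.≤ n → δ ℚ.≤ ℚ.∣ seq x n ∣)
  awayFromZero x (inj₁ (δ , 0<δ , N , f)) =
    δ , 0<δ , N , λ n N≤n → below (seq x n) δ (f n N≤n)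
  awayFromZero x (inj₂ (δ , 0<δ , N , f)) =
    δ , 0<δ , N , λ n N≤n → above (seq x n) δ (f n N≤n)

  inverse : ∀ a δ → 0ℚ ℚ.< δ → δ ℚ.≤ ℚ.∣ a ∣ → a ℚ.* invℚ a ≡ 1ℚ
  inverse a δ 0<δ δ≤a = invℚ-inverseʳ a λ a≡0 →
    ℚ.<-irrefl refl (ℚ.<-≤-trans 0<δ (subst (λ t → δ ℚ.≤ ℚ.∣ t ∣) a≡0 δ≤a))

  ∣inverse∣≤ : ∀ a r δ D → 0ℚ ℚ.< D → δ ℚ.* D ≡ 1ℚ →
               δ ℚ.≤ ℚ.∣ a ∣ → a ℚ.* r ≡ 1ℚ → ℚ.∣ r ∣ ℚ.≤ D
  ∣inverse∣≤ a r δ D 0<D δD≡1 δ≤a ar≡1 = begin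
    ℚ.∣ r ∣                        ≡⟨ sym (trans (cong (ℚ.∣ r ∣ ℚ.*_) δD≡1) (ℚ.*-identityʳ ℚ.∣ r ∣)) ⟩
    ℚ.∣ r ∣ ℚ.* (δ ℚ.* D)          ≤⟨ ℚ.*-monoˡ-≤-nonNeg ℚ.∣ r ∣ {{ℚ.∣-∣-nonNeg r}}
                                        (ℚ.*-monoʳ-≤-nonNeg D {{ℚ.nonNegative (ℚ.<⇒≤ 0<D)}} δ≤a) ⟩
    ℚ.∣ r ∣ ℚ.* (ℚ.∣ a ∣ ℚ.* D)    ≡⟨ rearrange ℚ.∣ r ∣ ℚ.∣ a ∣ D ⟩
    (ℚ.∣ a ∣ ℚ.* ℚ.∣ r ∣) ℚ.* D    ≡⟨ cong (ℚ._* D) (trans (sym (ℚ.∣p*q∣≡∣p∣*∣q∣ a r)) (cong ℚ.∣_∣ ar≡1)) ⟩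
    1ℚ ℚ.* D                       ≡⟨ ℚ.*-identityˡ D ⟩
    D                              ∎
    where
    open ℚ.≤-Reasoning
    rearrange : ∀ r a d → r ℚ.* (a ℚ.* d) ≡ (a ℚ.* r) ℚ.* d
    rearrange = solve 3 (λ r a d → r :* (a :* d) := (a :* r) :* d) refl

  inverse-close : ∀ a b r s D η → 0ℚ ℚ.< D →
    a ℚ.* r ≡ 1ℚ → b ℚ.* s ≡ 1ℚ → ℚ.∣ r ∣ ℚ.≤ D → ℚ.∣ s ∣ ℚ.≤ D →
    ℚ.∣ b ℚ.- a ∣ ℚ.≤ η → ℚ.∣ r ℚ.- s ∣ ℚ.≤ D ℚ.* (D ℚ.* η)
  inverse-close a b r s D η 0<D ar≡1 bs≡1 r≤D s≤D close = begin
    ℚ.∣ r ℚ.- s ∣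
      ≡⟨ cong ℚ.∣_∣ diff ⟩
    ℚ.∣ r ℚ.* (s ℚ.* (b ℚ.- a)) ∣
      ≡⟨ ℚ.∣p*q∣≡∣p∣*∣q∣ r (s ℚ.* (b ℚ.- a)) ⟩
    ℚ.∣ r ∣ ℚ.* ℚ.∣ s ℚ.* (b ℚ.- a) ∣
      ≤⟨ *-mono-≤ (ℚ.0≤∣p∣ (s ℚ.* (b ℚ.- a))) (ℚ.<⇒≤ 0<D) r≤D
           (ℚ.≤-trans (ℚ.≤-reflexive (ℚ.∣p*q∣≡∣p∣*∣q∣ s (b ℚ.- a)))
             (*-mono-≤ (ℚ.0≤∣p∣ (b ℚ.- a)) (ℚ.<⇒≤ 0<D) s≤D close)) ⟩
    D ℚ.* (D ℚ.* η) ∎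
    where
    open ℚ.≤-Reasoning
    regroup : ∀ a b r s →
      r ℚ.* (s ℚ.* (b ℚ.- a)) ≡ r ℚ.* (b ℚ.* s) ℚ.- s ℚ.* (a ℚ.* r)
    regroup = solve 4 (λ a b r s →
      r :* (s :* (b :- a)) := r :* (b :* s) :- s :* (a :* r)) refl
    diff : r ℚ.- s ≡ r ℚ.* (s ℚ.* (b ℚ.- a))
    diff = sym (trans (regroup a b r s)
      (cong₂ ℚ._-_ (trans (cong (r ℚ.*_) bs≡1) (ℚ.*-identityʳ r))
                   (trans (cong (s ℚ.*_) ar≡1) (ℚ.*-identityʳ s))))

inv : (x : ℝ) → x # 0ℝ → ℝ
inv x x#0 = mkℝ (λ n → invℚ (seq x n)) λ ε 0<ε →
  let δ , 0<δ , K , δ≤x = awayFromZero x x#0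
      D , 0<D , δD≡1    = scale δ 1ℚ 0<δ 0<1
      ε′ , 0<ε′ , Dε′≡ε = scale D ε 0<D 0<ε
      η , 0<η , Dη≡ε′   = scale D ε′ 0<D 0<ε′
      N , close         = cauchy x η 0<η
      x⁻¹ = λ n K≤n → inverse (seq x n) δ 0<δ (δ≤x n K≤n)
      x⁻¹≤D = λ n K≤n → ∣inverse∣≤ (seq x n) (invℚ (seq x n)) δ D 0<D δD≡1
                          (δ≤x n K≤n) (x⁻¹ n K≤n)
  in K ⊔ N , λ m n p q →
    let K≤m = ℕ.m⊔n≤o⇒m≤o K N p
        K≤n = ℕ.m⊔n≤o⇒m≤o K N q
    in ℚ.≤-trans
         (inverse-close (seq x m) (seq x n) (invℚ (seq x m)) (invℚ (seq x n)) D η 0<D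
           (x⁻¹ m K≤m) (x⁻¹ n K≤n) (x⁻¹≤D m K≤m) (x⁻¹≤D n K≤n)
           (close n m (ℕ.m⊔n≤o⇒n≤o K N q) (ℕ.m⊔n≤o⇒n≤o K N p)))
         (ℚ.≤-reflexive (trans (cong (D ℚ.*_) Dη≡ε′) Dε′≡ε))

data Symbol (A : Set) : Set where
  val : A → Symbol A
  □   : Symbol A
  ▷   : Symbol A

Γbin Γreal : Set
Γbin  = Symbol Bool
Γreal = Symbol ℝ

-- A finite prefix of the cells 0, 1, 2, …; all further cells hold □.
Tape : Set → Set
Tape A = List (Symbol A)

read : {A : Set} → Tape A → ℕ → Symbol A
read []      _       = □
read (s ∷ _) zero    = s
read (_ ∷ t) (suc n) = read t n

write : {A : Set} → Tape A → ℕ → Symbol A → Tape A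
write []      zero    s = s ∷ []
write []      (suc n) s = □ ∷ write [] n s
write (_ ∷ t) zero    s = s ∷ t
write (r ∷ t) (suc n) s = r ∷ write t n s

value : {A : Set} → Symbol A → Maybe A
value (val a) = just a
value □       = nothing
value ▷       = nothing

contents : {A : Set} → Tape A → List A
contents = mapMaybe value

startTape : {A : Set} → List A → Tape A
startTape w = ▷ ∷ map val w

data Move : Set where
  left stay right : Move

move : Move → ℕ → ℕ
move left  n = pred n
move stay  n = n
move right n = suc n

Word : Set
Word = List Bool

Oracle : Set₁
Oracle = Pred Word 0ℓ

Language : Set₁
Language = Pred Word 0ℓ

Answer : Oracle → Word → Bool → Set
Answer O y true  = y ∈ O
Answer O y false = y ∉ O

-- Coefficients, constant term first.
Polynomial : Set
Polynomial = List ℕ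

eval : Polynomial → ℕ → ℕ
eval p n = foldr (λ a v → a ℕ.+ n ℕ.* v) 0 p

data Sign : Set where
  pos zer neg : Sign

data HasSign : Γreal → Sign → Set where
  pos : ∀ {x} → 0ℝ < x → HasSign (val x) pos
  zer : ∀ {x} → x ≃ 0ℝ → HasSign (val x) zer
  neg : ∀ {x} → x < 0ℝ → HasSign (val x) neg
  □   : HasSign □ zer
  ▷   : HasSign ▷ zer

data Op : Set where
  idle add sub mul div put0 put1 put□ put▷ copy : Op

-- Result op xₕ xᵢ xⱼ z: the operation leaves z in the cell under h.
-- Arithmetic on □ or ▷ and division by zero have no result, and
-- the machine is then stuck without halting.
data Result : Op → (xₕ xᵢ xⱼ z : Γreal) → Set where
  idle : ∀ {h i j}   → Result idle h i j h
  add  : ∀ {h x y}   → Result add h (val x) (val y) (val (x + y))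
  sub  : ∀ {h x y}   → Result sub h (val x) (val y) (val (x - y))
  mul  : ∀ {h x y}   → Result mul h (val x) (val y) (val (x * y))
  div  : ∀ {h x y}   → (y#0 : y # 0ℝ) →
                       Result div h (val x) (val y) (val (x * inv y y#0))
  put0 : ∀ {h i j}   → Result put0 h i j (val 0ℝ)
  put1 : ∀ {h i j}   → Result put1 h i j (val 1ℝ)
  put□ : ∀ {h i j}   → Result put□ h i j □
  put▷ : ∀ {h i j}   → Result put▷ h i j ▷
  copy : ∀ {h i j}   → Result copy h i j i

-- The binary symbol denoted by a real symbol; reals other than 0 and 1
-- denote none.
data AsBinary : Γreal → Γbin → Set where
  bit0 : ∀ {x} → x ≃ 0ℝ → AsBinary (val x) (val false)
  bit1 : ∀ {x} → x ≃ 1ℝ → AsBinary (val x) (val true)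
  □    : AsBinary □ □
  ▷    : AsBinary ▷ ▷

data OracleOp : Set where
  idle copyBin copyᵢ copyⱼ put□ put▷ : OracleOp

-- OracleResult op o b xᵢ xⱼ z: with o, b, xᵢ, xⱼ under the oracle, binary
-- and reading heads, the operation leaves z in the cell under the oracle head.
data OracleResult : OracleOp → (o b : Γbin) (xᵢ xⱼ : Γreal) (z : Γbin) → Set where
  idle    : ∀ {o b i j}   → OracleResult idle o b i j o
  copyBin : ∀ {o b i j}   → OracleResult copyBin o b i j b
  copyᵢ   : ∀ {o b i j z} → AsBinary i z → OracleResult copyᵢ o b i j z
  copyⱼ   : ∀ {o b i j z} → AsBinary j z → OracleResult copyⱼ o b i j z
  put□    : ∀ {o b i j}   → OracleResult put□ o b i j □
  put▷    : ∀ {o b i j}   → OracleResult put▷ o b i j ▷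

record RealAction (State : Set) : Set where
  field
    state  : State
    symbol : Γbin
    realOp : Op
    orclOp : OracleOp
    moveᵇ moveₕ moveᵢ moveⱼ moveᵒ : Move

-- States are numbered from zero, so the start state is zero, the halting
-- state is the last one, and there is at least one state.
record RealMachine : Set where
  field
    lastState : ℕ

  State : Set
  State = Fin (suc lastState)

  field
    δ : State → Γbin → Sign → Bool → RealAction State

  start halt : State
  start = zero
  halt  = fromℕ lastState

  record Config : Set where
    constructor ⟨_,_,_,_,_,_,_,_,_⟩
    field
      state           : State
      binTape         : Tape Bool
      headᵇ           : ℕ
      realTape        : Tape ℝ
      headₕ headᵢ headⱼ : ℕ
      orclTape        : Tape Bool
      headᵒ           : ℕ

  initial : List Bool → List ℝ → Config
  initial w v = ⟨ start , startTape w , 0 , startTape v , 0 , 0 , 0 , startTape [] , 0 ⟩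

  query : Config → Word
  query c = contents (Config.orclTape c)

  output : Config → List ℝ
  output c = contents (take (Config.headₕ c) (Config.realTape c))

  after : Config → RealAction State → Γreal → Γbin → Config
  after c a z y =
    ⟨ A.state
    , write C.binTape C.headᵇ A.symbol
    , move A.moveᵇ C.headᵇ
    , write C.realTape C.headₕ z
    , move A.moveₕ C.headₕ
    , move A.moveᵢ C.headᵢ
    , move A.moveⱼ C.headⱼ
    , write C.orclTape C.headᵒ y
    , move A.moveᵒ C.headᵒ
    ⟩
    where
    module A = RealAction a
    module C = Config c

  data Step (O : Oracle) (c : Config) : Config → Set where
    step : let open Config c
               b  = read binTape headᵇ
               xₕ = read realTape headₕ
               xᵢ = read realTape headᵢ
               xⱼ = read realTape headⱼ
               o  = read orclTape headᵒ
           in ∀ {s r z y} →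
              state ≢ halt →
              HasSign xᵢ s →
              Answer O (query c) r →
              let a = δ state b s r in
              Result (RealAction.realOp a) xₕ xᵢ xⱼ z →
              OracleResult (RealAction.orclOp a) o b xᵢ xⱼ y →
              Step O c (after c a z y)

  data Run (O : Oracle) : ℕ → Config → Config → Set where
    done : ∀ {c} → Run O 0 c c
    _∷_  : ∀ {k c c′ c″} → Step O c c′ → Run O k c′ c″ → Run O (suc k) c c″

  HaltsWithin : Oracle → ℕ → List Bool → List ℝ → Config → Set
  HaltsWithin O t w v c =
    Config.state c ≡ halt × ∃[ k ] k ℕ.≤ t × Run O k (initial w v) c

  OutputsOne : Config → Set
  OutputsOne c = Pointwise _≃_ (output c) (1ℝ ∷ [])

  DecidesWithin : Oracle → Polynomial → Language → Set
  DecidesWithin O p L = ∀ w →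
    ∃[ c ] HaltsWithin O (eval p (length w)) w [] c × (w ∈ L ⇔ OutputsOne c)

Pℝ : Oracle → Pred Language 0ℓ
Pℝ O L = ∃[ M ] ∃[ p ] RealMachine.DecidesWithin M O p L

-- Nondeterministic Turing machines with a work tape and an oracle tape.
-- As above, each transition depends on the answer to the current query.
-- Acceptance is reaching the last state; a computation that gets stuck in
-- any other state rejects.

record NondetAction (State : Set) : Set where
  field
    state                 : State
    workSymbol orclSymbol : Γbin
    workMove orclMove     : Move

record NondetMachine : Set where
  field
    lastState : ℕ

  State : Set
  State = Fin (suc lastState)

  field
    δ : State → (work orcl : Γbin) → Bool → List (NondetAction State)

  start accept : State
  start  = zero
  accept = fromℕ lastState

  record Config : Set where
    constructor ⟨_,_,_,_,_⟩
    field
      state    : State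
      workTape : Tape Bool
      workHead : ℕ
      orclTape : Tape Bool
      orclHead : ℕ

  initial : Word → Config
  initial w = ⟨ start , startTape w , 0 , startTape [] , 0 ⟩

  query : Config → Word
  query c = contents (Config.orclTape c)

  after : Config → NondetAction State → Config
  after c a =
    ⟨ A.state
    , write C.workTape C.workHead A.workSymbol
    , move A.workMove C.workHead
    , write C.orclTape C.orclHead A.orclSymbol
    , move A.orclMove C.orclHead
    ⟩
    where
    module A = NondetAction a
    module C = Config c

  data Step (O : Oracle) (c : Config) : Config → Set where
    step : let open Config c in
           ∀ {r a} →
           state ≢ accept →
           Answer O (query c) r →
           a ∈ˡ δ state (read workTape workHead) (read orclTape orclHead) r →
           Step O c (after c a)

  data Run (O : Oracle) : ℕ → Config → Config → Set where
    done : ∀ {c} → Run O 0 c c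
    _∷_  : ∀ {k c c′ c″} → Step O c c′ → Run O k c′ c″ → Run O (suc k) c c″

  Accepts : Oracle → Word → Set
  Accepts O w = ∃[ k ] ∃[ c ] Run O k (initial w) c × Config.state c ≡ accept

  RunsWithin : Oracle → Polynomial → Set
  RunsWithin O p = ∀ w {k c} → Run O k (initial w) c → k ℕ.≤ eval p (length w)

NP : Oracle → Pred Language 0ℓ
NP O L = ∃[ M ] ∃[ p ]
  NondetMachine.RunsWithin M O p × (∀ w → w ∈ L ⇔ NondetMachine.Accepts M O w)

{-# OPTIONS --safe #-}
-- Without real inputs every number on the real tape is represented by a constant
-- sequence of rationals, so a real machine is simulated by a total, deterministic
-- machine over ℚ, for which signs and the final output are decidable. This gives the
-- argument of Baker, Gill and Solovay: at stage k the k-th machine is run on 1ⁿ,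
-- where n = tower (1 + k), for 2ⁿ - 1 steps and with the oracle built so far, and unless
-- it outputs 1, all words of length n which it did not query enter the oracle. Later
-- stages add only words of length at least 2ⁿ, which that run is too short to query.
-- The language of those w for which the oracle has a word of length |w| is in NP.
module Submission where

open import Defs
open import Data.Bool using (Bool; true; false; not; _∨_)
import Data.Bool.Properties as Bool
open import Data.Fin using (Fin; zero; suc; fromℕ; toℕ)
import Data.Fin.Properties as Fin
open import Data.List using (List; []; _∷_; _++_; length; map; replicate; take)
open import Data.List.Membership.Propositional using () renaming (_∈_ to _∈ˡ_; _∉_ to _∉ˡ_)
import Data.List.Membership.DecPropositional as DecMembership
import Data.List.Properties as List
open import Data.List.Relation.Binary.Pointwise using (Pointwise; []; _∷_)
open import Data.List.Relation.Unary.Any using (here; there)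
open import Data.Nat as ℕ using (ℕ; zero; suc; pred; z≤n; s≤s)
import Data.Nat.Properties as ℕ
open import Data.Nat.ListAction using (sum)
open import Data.Nat.Tactic.RingSolver using (solve-∀)
open import Data.Product using (∃-syntax; _×_; _,_; proj₁; proj₂)
open import Data.Product.Function.NonDependent.Propositional using (_×-↠_)
open import Data.Rational as ℚ using (ℚ; 0ℚ; 1ℚ)
import Data.Rational.Properties as ℚ
open import Algebra.Properties.Group ℚ.+-0-group using (x∙y⁻¹≈ε⇒x≈y)
open import Data.Sum using (_⊎_; inj₁; inj₂)
open import Data.Vec as Vec using (Vec; []; _∷_)
import Data.Vec.Properties as Vec
open import Function using (_↠_; mk↠ₛ; Surjection; _∘_; _⇔_; Equivalence; mk⇔; id)
open import Function.Construct.Composition using (_↠-∘_; _⇔-∘_)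
open import Function.Construct.Symmetry using (⇔-sym)
open import Relation.Binary.Definitions using (tri<; tri≈; tri>)
open import Relation.Binary.PropositionalEquality
open import Relation.Nullary using (¬_; Dec; yes; no; does; contradiction)
open import Relation.Nullary.Decidable using (¬?; _×-dec_; dec-true; dec-false)
open import Relation.Unary using (_∈_; _⊈_)

-- Arithmetic

n<2^n : ∀ n → n ℕ.< 2 ℕ.^ n
n<2^n zero    = s≤s z≤n
n<2^n (suc n) = begin-strict
  suc n                    ≤⟨ n<2^n n ⟩
  2 ℕ.^ n                  <⟨ ℕ.m<m+n (2 ℕ.^ n) (ℕ.m^n>0 2 n) ⟩
  2 ℕ.^ n ℕ.+ 2 ℕ.^ n      ≡⟨ cong (2 ℕ.^ n ℕ.+_) (ℕ.+-identityʳ (2 ℕ.^ n)) ⟨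
  2 ℕ.^ suc n              ∎
  where open ℕ.≤-Reasoning

-- Write m = 4c + z and split the exponent into 2c and 2c + z. Applying `n<2^n` to both halves
-- bounds the power below by (2c + 1)(2c + z + 1), whose expansion exceeds c(4c + z).
c*m<2^m : ∀ c {m} → 4 ℕ.* c ℕ.≤ m → c ℕ.* m ℕ.< 2 ℕ.^ m
c*m<2^m c {m} 4c≤m with ℕ.m≤n⇒∃[o]m+o≡n 4c≤m
... | z , refl = begin-strict
  c ℕ.* (4 ℕ.* c ℕ.+ z)                              <⟨ ℕ.m<m+n _ (s≤s z≤n) ⟩
  c ℕ.* (4 ℕ.* c ℕ.+ z) ℕ.+ suc (4 ℕ.* c ℕ.+ z ℕ.+ c ℕ.* z)
                                                     ≡⟨ expand c z ⟩
  suc (2 ℕ.* c) ℕ.* suc (2 ℕ.* c ℕ.+ z)              ≤⟨ ℕ.*-mono-≤ (n<2^n (2 ℕ.* c)) (n<2^n (2 ℕ.* c ℕ.+ z)) ⟩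
  2 ℕ.^ (2 ℕ.* c) ℕ.* 2 ℕ.^ (2 ℕ.* c ℕ.+ z)          ≡⟨ ℕ.^-distribˡ-+-* 2 (2 ℕ.* c) (2 ℕ.* c ℕ.+ z) ⟨
  2 ℕ.^ (2 ℕ.* c ℕ.+ (2 ℕ.* c ℕ.+ z))                ≡⟨ cong (2 ℕ.^_) (regroup c z) ⟩
  2 ℕ.^ (4 ℕ.* c ℕ.+ z)                              ∎
  where
  open ℕ.≤-Reasoning
  expand : ∀ c z → c ℕ.* (4 ℕ.* c ℕ.+ z) ℕ.+ suc (4 ℕ.* c ℕ.+ z ℕ.+ c ℕ.* z)
                   ≡ suc (2 ℕ.* c) ℕ.* suc (2 ℕ.* c ℕ.+ z)
  expand = solve-∀
  regroup : ∀ c z → 2 ℕ.* c ℕ.+ (2 ℕ.* c ℕ.+ z) ≡ 4 ℕ.* c ℕ.+ z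
  regroup = solve-∀

-- Follows Horner's scheme: each multiplication by the argument adds m to the exponent, and adding a
-- coefficient a costs at most a further factor 2^a.
eval-2^ : ∀ p m → eval p (2 ℕ.^ m) ℕ.≤ 2 ℕ.^ (sum p ℕ.+ length p ℕ.* m)
eval-2^ []      m = z≤n
eval-2^ (a ∷ p) m = begin
  a ℕ.+ 2 ℕ.^ m ℕ.* eval p (2 ℕ.^ m)   ≤⟨ ℕ.+-monoʳ-≤ a (ℕ.*-monoʳ-≤ (2 ℕ.^ m) (eval-2^ p m)) ⟩
  a ℕ.+ 2 ℕ.^ m ℕ.* 2 ℕ.^ e            ≡⟨ cong (a ℕ.+_) (ℕ.^-distribˡ-+-* 2 m e) ⟨
  a ℕ.+ 2 ℕ.^ (m ℕ.+ e)                ≤⟨ ℕ.+-monoˡ-≤ _ (ℕ.m≤m*n a (2 ℕ.^ (m ℕ.+ e)) {{ℕ.m^n≢0 2 (m ℕ.+ e)}}) ⟩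
  a ℕ.* 2 ℕ.^ (m ℕ.+ e) ℕ.+ 2 ℕ.^ (m ℕ.+ e)
                                       ≡⟨ ℕ.+-comm _ (2 ℕ.^ (m ℕ.+ e)) ⟩
  suc a ℕ.* 2 ℕ.^ (m ℕ.+ e)            ≤⟨ ℕ.*-monoˡ-≤ (2 ℕ.^ (m ℕ.+ e)) (n<2^n a) ⟩
  2 ℕ.^ a ℕ.* 2 ℕ.^ (m ℕ.+ e)          ≡⟨ ℕ.^-distribˡ-+-* 2 a (m ℕ.+ e) ⟨
  2 ℕ.^ (a ℕ.+ (m ℕ.+ e))              ≡⟨ cong (2 ℕ.^_) (regroup a m (sum p) (length p)) ⟩
  2 ℕ.^ (a ℕ.+ sum p ℕ.+ suc (length p) ℕ.* m) ∎
  where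
  open ℕ.≤-Reasoning
  e : ℕ
  e = sum p ℕ.+ length p ℕ.* m
  regroup : ∀ a m s l → a ℕ.+ (m ℕ.+ (s ℕ.+ l ℕ.* m)) ≡ a ℕ.+ s ℕ.+ suc l ℕ.* m
  regroup = solve-∀

-- For arguments of the form 2^m it suffices to compare exponents: linear in m on the left, 2^m on
-- the right.
eval-2^-subexponential : ∀ p → ∃[ b ] (∀ {m} → b ℕ.≤ m → eval p (2 ℕ.^ m) ℕ.< 2 ℕ.^ (2 ℕ.^ m))
eval-2^-subexponential p = 4 ℕ.* c , λ {m} 4c≤m → begin-strict
  eval p (2 ℕ.^ m)                     ≤⟨ eval-2^ p m ⟩
  2 ℕ.^ (sum p ℕ.+ length p ℕ.* m)     <⟨ ℕ.^-monoʳ-< 2 (s≤s (s≤s z≤n)) (begin-strict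
    sum p ℕ.+ length p ℕ.* m               ≤⟨ ℕ.+-monoˡ-≤ _ (ℕ.m≤m*n (sum p) m {{ℕ.>-nonZero (ℕ.≤-trans (s≤s z≤n) 4c≤m)}}) ⟩
    sum p ℕ.* m ℕ.+ length p ℕ.* m         ≡⟨ ℕ.*-distribʳ-+ m (sum p) (length p) ⟨
    (sum p ℕ.+ length p) ℕ.* m             ≤⟨ ℕ.*-monoˡ-≤ m (ℕ.n≤1+n (sum p ℕ.+ length p)) ⟩
    c ℕ.* m                                <⟨ c*m<2^m c 4c≤m ⟩
    2 ℕ.^ m                                ∎) ⟩
  2 ℕ.^ (2 ℕ.^ m)                      ∎
  where
  open ℕ.≤-Reasoning
  c : ℕ
  -- The successor makes the threshold 4c positive, so m is nonzero and `sum p ≤ sum p * m` is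
  -- available.
  c = suc (sum p ℕ.+ length p)

tower : ℕ → ℕ
tower zero    = 1
tower (suc k) = 2 ℕ.^ tower k

k<tower : ∀ k → k ℕ.< tower k
k<tower zero    = s≤s z≤n
k<tower (suc k) = ℕ.<-≤-trans (s≤s (k<tower k)) (n<2^n (tower k))

tower-mono-≤ : ∀ {j k} → j ℕ.≤ k → tower j ℕ.≤ tower k
tower-mono-≤ {k = k} z≤n = ℕ.≤-trans (s≤s z≤n) (k<tower k)
tower-mono-≤ (s≤s j≤k)   = ℕ.^-monoʳ-≤ 2 (tower-mono-≤ j≤k)

-- Enumeration of transition tables

-- Walks along the antidiagonals of ℕ × ℕ; from the end `(a , 0)` of one it jumps to the start of
-- the next.
next : ℕ × ℕ → ℕ × ℕ
next (a , zero)  = 0 , suc a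
next (a , suc b) = suc a , b

unpair : ℕ → ℕ × ℕ
unpair zero    = 0 , 0
unpair (suc n) = next (unpair n)

-- Induction backwards along `next`, on the antidiagonal and the position in it. The lower bound on
-- the index is what later yields stages beyond any given one.
unpair-onto : ∀ a b → ∃[ n ] a ℕ.+ b ℕ.≤ n × unpair n ≡ (a , b)
unpair-onto a b = onto (a ℕ.+ b) a b refl
  where
  onto : ∀ s a b → a ℕ.+ b ≡ s → ∃[ n ] s ℕ.≤ n × unpair n ≡ (a , b)
  onto s       (suc a) b       eq   =
    let n , s≤n , hit = onto s a (suc b) (trans (ℕ.+-suc a b) eq)
    in suc n , ℕ.m≤n⇒m≤1+n s≤n , cong next hit
  onto zero    zero    zero    _    = 0 , z≤n , refl
  onto (suc s) zero    (suc b) refl =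
    let n , s≤n , hit = onto s s 0 (ℕ.+-identityʳ s)
    in suc n , s≤s s≤n , cong next hit

infixr 2 _⊗_

_⊗_ : {A B : Set} → ℕ ↠ A → ℕ ↠ B → ℕ ↠ (A × B)
f ⊗ g = (f ×-↠ g) ↠-∘ mk↠ₛ {to = unpair} λ (a , b) →
  let n , _ , hit = unpair-onto a b in n , hit

symbols : ℕ ↠ Γbin
symbols = mk↠ₛ {to = λ { 0 → val true ; 1 → val false ; 2 → □ ; _ → ▷ }}
  λ { (val true) → 0 , refl ; (val false) → 1 , refl ; □ → 2 , refl ; ▷ → 3 , refl }

moves : ℕ ↠ Move
moves = mk↠ₛ {to = λ { 0 → left ; 1 → stay ; _ → right }}
  λ { left → 0 , refl ; stay → 1 , refl ; right → 2 , refl }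

ops : ℕ ↠ Op
ops = mk↠ₛ
  {to = λ { 0 → idle ; 1 → add ; 2 → sub ; 3 → mul ; 4 → div
          ; 5 → put0 ; 6 → put1 ; 7 → put□ ; 8 → put▷ ; _ → copy }}
  λ { idle → 0 , refl ; add → 1 , refl ; sub → 2 , refl ; mul → 3 , refl ; div → 4 , refl
    ; put0 → 5 , refl ; put1 → 6 , refl ; put□ → 7 , refl ; put▷ → 8 , refl ; copy → 9 , refl }

oracleOps : ℕ ↠ OracleOp
oracleOps = mk↠ₛ
  {to = λ { 0 → idle ; 1 → copyBin ; 2 → copyᵢ ; 3 → copyⱼ ; 4 → put□ ; _ → put▷ }}
  λ { idle → 0 , refl ; copyBin → 1 , refl ; copyᵢ → 2 , refl
    ; copyⱼ → 3 , refl ; put□ → 4 , refl ; put▷ → 5 , refl }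

fins : ∀ q → ℕ ↠ Fin (suc q)
fins q = mk↠ₛ {to = clamp q} λ i → toℕ i , clamp-toℕ q i
  where
  clamp : ∀ q → ℕ → Fin (suc q)
  clamp zero    _       = zero
  clamp (suc q) zero    = zero
  clamp (suc q) (suc m) = suc (clamp q m)
  clamp-toℕ : ∀ q i → clamp q (toℕ i) ≡ i
  clamp-toℕ zero    zero    = refl
  clamp-toℕ (suc q) zero    = refl
  clamp-toℕ (suc q) (suc i) = cong suc (clamp-toℕ q i)

vecs : {A : Set} → ℕ ↠ A → ∀ n → ℕ ↠ Vec A n
vecs f zero    = mk↠ₛ {to = λ _ → []} λ { [] → 0 , refl }
vecs f (suc n) =
  mk↠ₛ {to = λ (x , xs) → x ∷ xs} (λ { (x ∷ xs) → (x , xs) , refl }) ↠-∘ (f ⊗ vecs f n)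

actions : ∀ q → ℕ ↠ RealAction (Fin (suc q))
actions q = mk↠ₛ
  {to = λ (s , b , r , o , m₁ , m₂ , m₃ , m₄ , m₅) → record
    { state = s ; symbol = b ; realOp = r ; orclOp = o
    ; moveᵇ = m₁ ; moveₕ = m₂ ; moveᵢ = m₃ ; moveⱼ = m₄ ; moveᵒ = m₅ }}
  (λ a → let open RealAction a in
    (state , symbol , realOp , orclOp , moveᵇ , moveₕ , moveᵢ , moveⱼ , moveᵒ) , refl)
  ↠-∘ (fins q ⊗ symbols ⊗ ops ⊗ oracleOps ⊗ moves ⊗ moves ⊗ moves ⊗ moves ⊗ moves)

-- Transition functions as finite tables

Transition : ℕ → Set
Transition q = Fin (suc q) → Γbin → Sign → Bool → RealAction (Fin (suc q))

infix 4 _≗δ_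

-- Reading a transition function back from its table recovers it pointwise, and identity of
-- functions would require extensionality.
_≗δ_ : ∀ {q} → Transition q → Transition q → Set
δ ≗δ δ′ = ∀ s b σ r → δ s b σ r ≡ δ′ s b σ r

PerBool PerSign PerSymbol : Set → Set
PerBool A   = A × A
PerSign A   = A × A × A
PerSymbol A = A × A × A × A

module _ {A : Set} where

  tabulateBool : (Bool → A) → PerBool A
  tabulateBool f = f true , f false

  lookupBool : PerBool A → Bool → A
  lookupBool (x , _) true  = x
  lookupBool (_ , y) false = y

  lookupBool∘tabulate : ∀ f r → lookupBool (tabulateBool f) r ≡ f r
  lookupBool∘tabulate f true  = refl
  lookupBool∘tabulate f false = refl

  tabulateSign : (Sign → A) → PerSign A
  tabulateSign f = f pos , f zer , f neg

  lookupSign : PerSign A → Sign → A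
  lookupSign (x , _ , _) pos = x
  lookupSign (_ , y , _) zer = y
  lookupSign (_ , _ , z) neg = z

  lookupSign∘tabulate : ∀ f σ → lookupSign (tabulateSign f) σ ≡ f σ
  lookupSign∘tabulate f pos = refl
  lookupSign∘tabulate f zer = refl
  lookupSign∘tabulate f neg = refl

  tabulateSymbol : (Γbin → A) → PerSymbol A
  tabulateSymbol f = f (val true) , f (val false) , f □ , f ▷

  lookupSymbol : PerSymbol A → Γbin → A
  lookupSymbol (x , _ , _ , _) (val true)  = x
  lookupSymbol (_ , y , _ , _) (val false) = y
  lookupSymbol (_ , _ , z , _) □           = z
  lookupSymbol (_ , _ , _ , w) ▷           = w

  lookupSymbol∘tabulate : ∀ f b → lookupSymbol (tabulateSymbol f) b ≡ f b
  lookupSymbol∘tabulate f (val true)  = refl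
  lookupSymbol∘tabulate f (val false) = refl
  lookupSymbol∘tabulate f □           = refl
  lookupSymbol∘tabulate f ▷           = refl

Table : ℕ → Set
Table q = Vec (PerSymbol (PerSign (PerBool (RealAction (Fin (suc q)))))) (suc q)

tables : ∀ q → ℕ ↠ Table q
tables q = vecs (perSymbol (perSign (perBool (actions q)))) (suc q)
  where
  perBool : ∀ {A} → ℕ ↠ A → ℕ ↠ PerBool A
  perBool f = f ⊗ f
  perSign : ∀ {A} → ℕ ↠ A → ℕ ↠ PerSign A
  perSign f = f ⊗ f ⊗ f
  perSymbol : ∀ {A} → ℕ ↠ A → ℕ ↠ PerSymbol A
  perSymbol f = f ⊗ f ⊗ f ⊗ f

fromTable : ∀ {q} → Table q → Transition q
fromTable t s b σ r = lookupBool (lookupSign (lookupSymbol (Vec.lookup t s) b) σ) r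

toTable : ∀ {q} → Transition q → Table q
toTable δ = Vec.tabulate λ s → tabulateSymbol λ b → tabulateSign λ σ → tabulateBool λ r → δ s b σ r

fromTable∘toTable : ∀ {q} (δ : Transition q) → fromTable (toTable δ) ≗δ δ
fromTable∘toTable δ s b σ r
  rewrite Vec.lookup∘tabulate
            (λ s → tabulateSymbol λ b → tabulateSign λ σ → tabulateBool λ r → δ s b σ r) s
        | lookupSymbol∘tabulate (λ b → tabulateSign λ σ → tabulateBool λ r → δ s b σ r) b
        | lookupSign∘tabulate (λ σ → tabulateBool λ r → δ s b σ r) σ
        = lookupBool∘tabulate (δ s b σ) r

-- The first component of unpair only makes every transition function recur
-- at arbitrarily late stages.
nthTransition : ℕ → ∃[ q ] Transition q
nthTransition k =
  let q , m = unpair (proj₂ (unpair k)) in q , fromTable (Surjection.to (tables q) m)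

-- Take for k the code of the pair of l and a code i of the transition function; pairing gives l + i
-- ≤ k, hence l ≤ k.
nthTransition-recurs : ∀ {q} (δ : Transition q) l →
  ∃[ k ] l ℕ.≤ k × ∃[ δ′ ] nthTransition k ≡ (q , δ′) × δ′ ≗δ δ
nthTransition-recurs {q} δ l =
  let m , m↦δ = Surjection.strictlySurjective (tables q) (toTable δ)
      i , _ , i↦qm     = unpair-onto q m
      k , l+i≤k , k↦li = unpair-onto l i
  in k , ℕ.m+n≤o⇒m≤o l l+i≤k , fromTable (toTable δ) ,
     trans (cong (decode ∘ unpair ∘ proj₂) k↦li)
       (trans (cong decode i↦qm) (cong (λ t → q , fromTable t) m↦δ)) ,
     fromTable∘toTable δ
  where
  decode : ℕ × ℕ → ∃[ q ] Transition q
  decode (q , m) = q , fromTable (Surjection.to (tables q) m)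

-- Simulation over ℚ

record ℚConfig (q : ℕ) : Set where
  constructor ⟨_,_,_,_,_,_,_,_,_⟩
  field
    state             : Fin (suc q)
    binTape           : Tape Bool
    headᵇ             : ℕ
    realTape          : Tape ℚ
    headₕ headᵢ headⱼ : ℕ
    orclTape          : Tape Bool
    headᵒ             : ℕ

-- Where the real machine is stuck, the following functions give arbitrary results.

signℚ : Symbol ℚ → Sign
signℚ □       = zer
signℚ ▷       = zer
signℚ (val p) with ℚ.<-cmp 0ℚ p
... | tri< _ _ _ = pos
... | tri≈ _ _ _ = zer
... | tri> _ _ _ = neg

arith : (ℚ → ℚ → ℚ) → (i j : Symbol ℚ) → Symbol ℚ
arith f (val p) (val q) = val (f p q)
arith f _       _       = □

applyOp : Op → (h i j : Symbol ℚ) → Symbol ℚ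
applyOp idle h i j = h
applyOp add  h i j = arith ℚ._+_ i j
applyOp sub  h i j = arith ℚ._-_ i j
applyOp mul  h i j = arith ℚ._*_ i j
applyOp div  h i j = arith (λ p q → p ℚ.* invℚ q) i j
applyOp put0 h i j = val 0ℚ
applyOp put1 h i j = val 1ℚ
applyOp put□ h i j = □
applyOp put▷ h i j = ▷
applyOp copy h i j = i

toBinary : Symbol ℚ → Γbin
toBinary (val p) = val (not (does (p ℚ.≟ 0ℚ)))
toBinary □       = □
toBinary ▷       = ▷

applyOracleOp : OracleOp → (o b : Γbin) (i j : Symbol ℚ) → Γbin
applyOracleOp idle    o b i j = o
applyOracleOp copyBin o b i j = b
applyOracleOp copyᵢ   o b i j = toBinary i
applyOracleOp copyⱼ   o b i j = toBinary j
applyOracleOp put□    o b i j = □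
applyOracleOp put▷    o b i j = ▷

afterℚ : ∀ {q} → ℚConfig q → RealAction (Fin (suc q)) → ℚConfig q
afterℚ c a =
  ⟨ A.state
  , write binTape headᵇ A.symbol
  , move A.moveᵇ headᵇ
  , write realTape headₕ (applyOp A.realOp (read realTape headₕ) xᵢ xⱼ)
  , move A.moveₕ headₕ
  , move A.moveᵢ headᵢ
  , move A.moveⱼ headⱼ
  , write orclTape headᵒ
      (applyOracleOp A.orclOp (read orclTape headᵒ) (read binTape headᵇ) xᵢ xⱼ)
  , move A.moveᵒ headᵒ
  ⟩
  where
  open ℚConfig c
  module A = RealAction a
  xᵢ xⱼ : Symbol ℚ
  xᵢ = read realTape headᵢ
  xⱼ = read realTape headⱼ

queryℚ : ∀ {q} → ℚConfig q → Word
queryℚ c = contents (ℚConfig.orclTape c)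

outputℚ : ∀ {q} → ℚConfig q → List ℚ
outputℚ c = contents (take (ℚConfig.headₕ c) (ℚConfig.realTape c))

initialℚ : ∀ {q} → Word → ℚConfig q
initialℚ w = ⟨ zero , startTape w , 0 , startTape [] , 0 , 0 , 0 , startTape [] , 0 ⟩

actionℚ : ∀ {q} → Transition q → (Word → Bool) → ℚConfig q → RealAction (Fin (suc q))
actionℚ δ o c = δ state (read binTape headᵇ) (signℚ (read realTape headᵢ)) (o (queryℚ c))
  where open ℚConfig c

-- Halted configurations are fixed points, so a run for any sufficient number of steps ends in the
-- halting configuration.
stepℚ : ∀ {q} → Transition q → (Word → Bool) → ℚConfig q → ℚConfig q
stepℚ {q} δ o c with ℚConfig.state c Fin.≟ fromℕ q
... | yes _ = c
... | no  _ = afterℚ c (actionℚ δ o c)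

runℚ : ∀ {q} → Transition q → (Word → Bool) → ℕ → ℚConfig q → ℚConfig q
runℚ δ o zero    c = c
runℚ δ o (suc t) c = runℚ δ o t (stepℚ δ o c)

-- The answer for the current oracle tape is supplied at every step, so each of the first t
-- configurations contributes one query.
queriesℚ : ∀ {q} → Transition q → (Word → Bool) → ℕ → ℚConfig q → List Word
queriesℚ δ o zero    c = []
queriesℚ δ o (suc t) c = queryℚ c ∷ queriesℚ δ o t (stepℚ δ o c)

stepℚ-cong : ∀ {q} {δ δ′ : Transition q} {o o′} c → δ ≗δ δ′ →
             o (queryℚ c) ≡ o′ (queryℚ c) → stepℚ δ o c ≡ stepℚ δ′ o′ c
stepℚ-cong {q} {δ} {δ′} {o} c δ≗ o≡ with ℚConfig.state c Fin.≟ fromℕ q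
... | yes _ = refl
... | no  _ = cong (afterℚ c)
  (trans (δ≗ state b σ (o (queryℚ c))) (cong (δ′ state b σ) o≡))
  where
  open ℚConfig c
  b : Γbin
  b = read binTape headᵇ
  σ : Sign
  σ = signℚ (read realTape headᵢ)

-- The oracle enters a run only through its answers to the recorded queries. This permits changing
-- the oracle elsewhere and replacing a transition function by its tabulated copy.
runℚ-cong : ∀ {q} {δ δ′ : Transition q} {o o′} t c → δ ≗δ δ′ →
            (∀ {y} → y ∈ˡ queriesℚ δ o t c → o y ≡ o′ y) → runℚ δ o t c ≡ runℚ δ′ o′ t c
runℚ-cong zero    c δ≗ o≗ = refl
runℚ-cong {δ = δ} {o = o} (suc t) c δ≗ o≗ =
  trans (runℚ-cong t (stepℚ δ o c) δ≗ (o≗ ∘ there))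
        (cong (runℚ _ _ t) (stepℚ-cong c δ≗ (o≗ (here refl))))

runℚ-halted : ∀ {q} (δ : Transition q) o t c → ℚConfig.state c ≡ fromℕ q → runℚ δ o t c ≡ c
runℚ-halted δ o zero c _ = refl
runℚ-halted {q} δ o (suc t) c halted with ℚConfig.state c Fin.≟ fromℕ q
... | yes _      = runℚ-halted δ o t c halted
... | no running = contradiction halted running

runℚ-+ : ∀ {q} (δ : Transition q) o s t c → runℚ δ o (s ℕ.+ t) c ≡ runℚ δ o t (runℚ δ o s c)
runℚ-+ δ o zero    t c = refl
runℚ-+ δ o (suc s) t c = runℚ-+ δ o s t (stepℚ δ o c)

length-queriesℚ : ∀ {q} (δ : Transition q) o t c → length (queriesℚ δ o t c) ≡ t
length-queriesℚ δ o zero    c = refl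
length-queriesℚ δ o (suc t) c = cong suc (length-queriesℚ δ o t (stepℚ δ o c))

-- Length of queries

length-contents-∷ : {A : Set} (s : Symbol A) (t : Tape A) →
  length (contents t) ℕ.≤ length (contents (s ∷ t)) ×
  length (contents (s ∷ t)) ℕ.≤ suc (length (contents t))
length-contents-∷ (val _) t = ℕ.n≤1+n _ , ℕ.≤-refl
length-contents-∷ □       t = ℕ.≤-refl , ℕ.n≤1+n _
length-contents-∷ ▷       t = ℕ.≤-refl , ℕ.n≤1+n _

length-contents-write : {A : Set} (t : Tape A) (n : ℕ) (s : Symbol A) →
                        length (contents (write t n s)) ℕ.≤ suc (length (contents t))
length-contents-write []            zero    s = proj₂ (length-contents-∷ s [])
length-contents-write []            (suc n) s = length-contents-write [] n s
length-contents-write (r ∷ t)       zero    s =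
  ℕ.≤-trans (proj₂ (length-contents-∷ s t)) (s≤s (proj₁ (length-contents-∷ r t)))
length-contents-write (val _ ∷ t)   (suc n) s = s≤s (length-contents-write t n s)
length-contents-write (□ ∷ t)       (suc n) s = length-contents-write t n s
length-contents-write (▷ ∷ t)       (suc n) s = length-contents-write t n s

length-queryℚ-stepℚ : ∀ {q} (δ : Transition q) o c →
                      length (queryℚ (stepℚ δ o c)) ℕ.≤ suc (length (queryℚ c))
length-queryℚ-stepℚ {q} δ o c with ℚConfig.state c Fin.≟ fromℕ q
... | yes _ = ℕ.n≤1+n _
... | no  _ = length-contents-write (ℚConfig.orclTape c) (ℚConfig.headᵒ c) _

-- One step writes one oracle cell and so lengthens the query by at most one. The bound is strict
-- because the configuration after the last step is not recorded.
∈queriesℚ⇒length< : ∀ {q} (δ : Transition q) o t c {y} → y ∈ˡ queriesℚ δ o t c →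
                    length y ℕ.< length (queryℚ c) ℕ.+ t
∈queriesℚ⇒length< δ o (suc t) c (here refl) = ℕ.m<m+n _ (s≤s z≤n)
∈queriesℚ⇒length< δ o (suc t) c {y} (there y∈) = begin-strict
  length y                                        <⟨ ∈queriesℚ⇒length< δ o t (stepℚ δ o c) y∈ ⟩
  length (queryℚ (stepℚ δ o c)) ℕ.+ t             ≤⟨ ℕ.+-monoˡ-≤ t (length-queryℚ-stepℚ δ o c) ⟩
  suc (length (queryℚ c)) ℕ.+ t                   ≡⟨ ℕ.+-suc (length (queryℚ c)) t ⟨
  length (queryℚ c) ℕ.+ suc t                     ∎
  where open ℕ.≤-Reasoning

-- Correspondence of real and rational computations

infix 4 _∼_

-- Demands a constant representing sequence, which is more than `x ≃ fromℚ p`. The operations on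
-- reals, including inversion through `invℚ`, act termwise and so preserve it.
data _∼_ : Γreal → Symbol ℚ → Set where
  val : ∀ {x p} → (∀ n → seq x n ≡ p) → val x ∼ val p
  □   : □ ∼ □
  ▷   : ▷ ∼ ▷

infix 4 _∼ᵗ_

_∼ᵗ_ : Tape ℝ → Tape ℚ → Set
_∼ᵗ_ = Pointwise _∼_

read-∼ : ∀ {t u} → t ∼ᵗ u → ∀ n → read t n ∼ read u n
read-∼ []        n       = □
read-∼ (s∼ ∷ t∼) zero    = s∼
read-∼ (s∼ ∷ t∼) (suc n) = read-∼ t∼ n

write-∼ : ∀ {t u x p} → t ∼ᵗ u → ∀ n → x ∼ p → write t n x ∼ᵗ write u n p
write-∼ []        zero    x∼ = x∼ ∷ []
write-∼ []        (suc n) x∼ = □ ∷ write-∼ [] n x∼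
write-∼ (s∼ ∷ t∼) zero    x∼ = x∼ ∷ t∼
write-∼ (s∼ ∷ t∼) (suc n) x∼ = s∼ ∷ write-∼ t∼ n x∼

take-∼ : ∀ {t u} n → t ∼ᵗ u → take n t ∼ᵗ take n u
take-∼ zero    _         = []
take-∼ (suc n) []        = []
take-∼ (suc n) (s∼ ∷ t∼) = s∼ ∷ take-∼ n t∼

contents-∼ : ∀ {t u} → t ∼ᵗ u →
             Pointwise (λ x p → ∀ n → seq x n ≡ p) (contents t) (contents u)
contents-∼ []            = []
contents-∼ (val x∼ ∷ t∼) = x∼ ∷ contents-∼ t∼
contents-∼ (□ ∷ t∼)      = contents-∼ t∼
contents-∼ (▷ ∷ t∼)      = contents-∼ t∼

≤-every-positive⇒≡0 : ∀ p → (∀ ε → 0ℚ ℚ.< ε → ℚ.∣ p ∣ ℚ.≤ ε) → p ≡ 0ℚ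
≤-every-positive⇒≡0 p small with ℚ.<-cmp 0ℚ ℚ.∣ p ∣
... | tri≈ _ 0≡∣p∣ _ = ℚ.∣p∣≡0⇒p≡0 p (sym 0≡∣p∣)
... | tri> _ _ ∣p∣<0 = contradiction (ℚ.<-≤-trans ∣p∣<0 (ℚ.0≤∣p∣ p)) (ℚ.<-irrefl refl)
... | tri< 0<∣p∣ _ _ =
  let ε , 0<ε , ε<∣p∣ = ℚ.<-dense 0<∣p∣
  in contradiction (ℚ.<-≤-trans ε<∣p∣ (small ε 0<ε)) (ℚ.<-irrefl refl)

module _ (x : ℝ) {p : ℚ} (x∼p : ∀ n → seq x n ≡ p) where

  ≃-fromℚ⇒≡ : ∀ {q} → x ≃ fromℚ q → p ≡ q
  ≃-fromℚ⇒≡ {q} x≃q = x∙y⁻¹≈ε⇒x≈y p q (≤-every-positive⇒≡0 (p ℚ.- q) λ ε 0<ε →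
    let N , close = x≃q ε 0<ε
    in subst (λ r → ℚ.∣ r ℚ.- q ∣ ℚ.≤ ε) (x∼p N) (close N ℕ.≤-refl))

  ≡⇒≃-fromℚ : ∀ {q} → p ≡ q → x ≃ fromℚ q
  ≡⇒≃-fromℚ refl ε 0<ε = 0 , λ n _ →
    subst (λ r → ℚ.∣ r ∣ ℚ.≤ ε)
      (sym (trans (cong (ℚ._- p) (x∼p n)) (ℚ.+-inverseʳ p))) (ℚ.<⇒≤ 0<ε)

  0ℝ<⇒0< : 0ℝ < x → 0ℚ ℚ.< p
  0ℝ<⇒0< (ε , 0<ε , N , above) = subst (0ℚ ℚ.<_) (x∼p N)
    (ℚ.<-≤-trans 0<ε (subst (ℚ._≤ seq x N) (ℚ.+-identityˡ ε) (above N ℕ.≤-refl)))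

  <0ℝ⇒<0 : x < 0ℝ → p ℚ.< 0ℚ
  <0ℝ⇒<0 (ε , 0<ε , N , below) = subst (ℚ._< 0ℚ) (x∼p N)
    (ℚ.<-≤-trans (subst (ℚ._< seq x N ℚ.+ ε) (ℚ.+-identityʳ (seq x N)) (ℚ.+-monoʳ-< (seq x N) 0<ε))
                 (below N ℕ.≤-refl))

sign-∼ : ∀ {x p s} → x ∼ p → HasSign x s → signℚ p ≡ s
sign-∼ □ □ = refl
sign-∼ ▷ ▷ = refl
sign-∼ {val x} {val p} (val x∼) (pos 0<x) with ℚ.<-cmp 0ℚ p
... | tri< _ _ _   = refl
... | tri≈ 0≮p _ _ = contradiction (0ℝ<⇒0< x x∼ 0<x) 0≮p
... | tri> 0≮p _ _ = contradiction (0ℝ<⇒0< x x∼ 0<x) 0≮p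
sign-∼ {val x} {val p} (val x∼) (zer x≃0) with ℚ.<-cmp 0ℚ p
... | tri< _ 0≢p _ = contradiction (sym (≃-fromℚ⇒≡ x x∼ x≃0)) 0≢p
... | tri≈ _ _ _   = refl
... | tri> _ 0≢p _ = contradiction (sym (≃-fromℚ⇒≡ x x∼ x≃0)) 0≢p
sign-∼ {val x} {val p} (val x∼) (neg x<0) with ℚ.<-cmp 0ℚ p
... | tri< _ _ p≮0 = contradiction (<0ℝ⇒<0 x x∼ x<0) p≮0
... | tri≈ _ _ p≮0 = contradiction (<0ℝ⇒<0 x x∼ x<0) p≮0
... | tri> _ _ _   = refl

applyOp-∼ : ∀ {op h i j z h′ i′ j′} → h ∼ h′ → i ∼ i′ → j ∼ j′ →
            Result op h i j z → z ∼ applyOp op h′ i′ j′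
applyOp-∼ h∼ i∼       j∼       idle    = h∼
applyOp-∼ h∼ (val x∼) (val y∼) add     = val λ n → cong₂ ℚ._+_ (x∼ n) (y∼ n)
applyOp-∼ h∼ (val x∼) (val y∼) sub     = val λ n → cong₂ ℚ._-_ (x∼ n) (y∼ n)
applyOp-∼ h∼ (val x∼) (val y∼) mul     = val λ n → cong₂ ℚ._*_ (x∼ n) (y∼ n)
applyOp-∼ h∼ (val x∼) (val y∼) (div _) = val λ n → cong₂ (λ p q → p ℚ.* invℚ q) (x∼ n) (y∼ n)
applyOp-∼ h∼ i∼       j∼       put0    = val λ _ → refl
applyOp-∼ h∼ i∼       j∼       put1    = val λ _ → refl
applyOp-∼ h∼ i∼       j∼       put□    = □
applyOp-∼ h∼ i∼       j∼       put▷    = ▷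
applyOp-∼ h∼ i∼       j∼       copy    = i∼

toBinary-∼ : ∀ {x p z} → x ∼ p → AsBinary x z → z ≡ toBinary p
toBinary-∼ {val x} {val p} (val x∼) (bit0 x≃0) =
  cong (val ∘ not) (sym (dec-true (p ℚ.≟ 0ℚ) (≃-fromℚ⇒≡ x x∼ x≃0)))
toBinary-∼ {val x} {val p} (val x∼) (bit1 x≃1) =
  cong (val ∘ not) (sym (dec-false (p ℚ.≟ 0ℚ) λ p≡0 →
    1≢0 (trans (sym (≃-fromℚ⇒≡ x x∼ x≃1)) p≡0)))
  where
  1≢0 : 1ℚ ≢ 0ℚ
  1≢0 ()
toBinary-∼ □ □ = refl
toBinary-∼ ▷ ▷ = refl

applyOracleOp-∼ : ∀ {op o b i j z i′ j′} → i ∼ i′ → j ∼ j′ →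
                  OracleResult op o b i j z → z ≡ applyOracleOp op o b i′ j′
applyOracleOp-∼ i∼ j∼ idle      = refl
applyOracleOp-∼ i∼ j∼ copyBin   = refl
applyOracleOp-∼ i∼ j∼ (copyᵢ z) = toBinary-∼ i∼ z
applyOracleOp-∼ i∼ j∼ (copyⱼ z) = toBinary-∼ j∼ z
applyOracleOp-∼ i∼ j∼ put□      = refl
applyOracleOp-∼ i∼ j∼ put▷      = refl

-- Boolean oracles, so that the simulation can compute the answers it needs.
asOracle : (Word → Bool) → Oracle
asOracle o y = o y ≡ true

Answer⇒≡ : ∀ o y r → Answer (asOracle o) y r → o y ≡ r
Answer⇒≡ o y true  y∈ = y∈
Answer⇒≡ o y false y∉ = Bool.¬-not y∉

module _ (M : RealMachine) (o : Word → Bool) where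
  open RealMachine M

  -- All discrete components are shared; only the real tapes need a relation.
  data _≈_ : Config → ℚConfig lastState → Set where
    tapes : ∀ {s bt hb t u h i j ot ho} → t ∼ᵗ u →
      ⟨ s , bt , hb , t , h , i , j , ot , ho ⟩ ≈ ⟨ s , bt , hb , u , h , i , j , ot , ho ⟩

  -- The sign and the oracle answer witnessed by the real step are the computed ones, so both
  -- machines take the same action.
  step-≈ : ∀ {c c′ d} → Step (asOracle o) c c′ → c ≈ d → c′ ≈ stepℚ δ o d
  step-≈ {c} {d = d} (step {s} {r} running sgn ans res ores) (tapes {i = i} {j} t∼)
    with ℚConfig.state d Fin.≟ fromℕ lastState
  ... | yes halted = contradiction halted running
  ... | no _
    rewrite sign-∼ (read-∼ t∼ i) sgn
          | Answer⇒≡ o (query c) r ans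
          | applyOracleOp-∼ (read-∼ t∼ i) (read-∼ t∼ j) ores
          = tapes (write-∼ t∼ _ (applyOp-∼ (read-∼ t∼ _) (read-∼ t∼ i) (read-∼ t∼ j) res))

  run-≈ : ∀ {k c c′ d} → Run (asOracle o) k c c′ → c ≈ d → c′ ≈ runℚ δ o k d
  run-≈ done     c≈ = c≈
  run-≈ (s ∷ ss) c≈ = run-≈ ss (step-≈ s c≈)

  outputsOne-≈ : ∀ {c d} → c ≈ d → OutputsOne c ⇔ outputℚ d ≡ 1ℚ ∷ []
  outputsOne-≈ (tapes {h = h} t∼) = mk⇔ (to (contents-∼ (take-∼ h t∼))) (from (contents-∼ (take-∼ h t∼)))
    where
    to : ∀ {xs ps} → Pointwise (λ x p → ∀ n → seq x n ≡ p) xs ps →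
         Pointwise _≃_ xs (1ℝ ∷ []) → ps ≡ 1ℚ ∷ []
    to {x ∷ []} (x∼ ∷ []) (x≃1 ∷ []) = cong (_∷ []) (≃-fromℚ⇒≡ x x∼ x≃1)
    from : ∀ {xs ps} → Pointwise (λ x p → ∀ n → seq x n ≡ p) xs ps →
           ps ≡ 1ℚ ∷ [] → Pointwise _≃_ xs (1ℝ ∷ [])
    from {x ∷ []} (x∼ ∷ []) eq = ≡⇒≃-fromℚ x x∼ (List.∷-injectiveˡ eq) ∷ []

  state-≈ : ∀ {c d} → c ≈ d → Config.state c ≡ ℚConfig.state d
  state-≈ (tapes _) = refl

  outputsOne⇔ : ∀ {s t w c} → HaltsWithin (asOracle o) s w [] c → s ℕ.≤ t →
                OutputsOne c ⇔ outputℚ (runℚ δ o t (initialℚ w)) ≡ 1ℚ ∷ []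
  outputsOne⇔ {t = t} {w} {c} (halted , k , k≤s , run) s≤t =
    subst (λ d → OutputsOne c ⇔ outputℚ d ≡ 1ℚ ∷ []) unchanged (outputsOne-≈ c≈)
    where
    d : ℚConfig lastState
    d = runℚ δ o k (initialℚ w)
    c≈ : c ≈ d
    c≈ = run-≈ run (tapes (▷ ∷ []))
    -- The simulation has halted after k steps and stands still for the remaining t - k.
    unchanged : d ≡ runℚ δ o t (initialℚ w)
    unchanged with ℕ.m≤n⇒∃[o]m+o≡n (ℕ.≤-trans k≤s s≤t)
    ... | e , refl = sym (trans (runℚ-+ δ o k e (initialℚ w))
                           (runℚ-halted δ o e d (trans (sym (state-≈ c≈)) halted)))

-- The guessing machine

read-length : {A : Set} (s : Tape A) {a : Symbol A} {t : Tape A} →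
              read (s ++ a ∷ t) (length s) ≡ a
read-length []      = refl
read-length (_ ∷ s) = read-length s

read-end : {A : Set} (s : Tape A) → read s (length s) ≡ □
read-end []      = refl
read-end (_ ∷ s) = read-end s

write-length : {A : Set} (s : Tape A) {a b : Symbol A} {t : Tape A} →
               write (s ++ a ∷ t) (length s) b ≡ (s ++ b ∷ []) ++ t
write-length []      = refl
write-length (r ∷ s) = cong (r ∷_) (write-length s)

write-end : {A : Set} (s : Tape A) {a : Symbol A} → write s (length s) a ≡ s ++ a ∷ []
write-end []      = refl
write-end (r ∷ s) = cong (r ∷_) (write-end s)

length-∷ʳ : {A : Set} (s : List A) {a : A} → length (s ++ a ∷ []) ≡ suc (length s)
length-∷ʳ s = trans (List.length-++ s) (ℕ.+-comm (length s) 1)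

contents-∷ʳ : {A : Set} (s : Tape A) {a : A} (y : List A) →
              contents (s ++ val a ∷ []) ++ y ≡ contents s ++ a ∷ y
contents-∷ʳ []          y = refl
contents-∷ʳ (val b ∷ s) y = cong (b ∷_) (contents-∷ʳ s y)
contents-∷ʳ (□ ∷ s)     y = contents-∷ʳ s y
contents-∷ʳ (▷ ∷ s)     y = contents-∷ʳ s y

read≢□⇒< : {A : Set} (t : Tape A) (n : ℕ) → read t n ≢ □ → n ℕ.< length t
read≢□⇒< []      n       s≢□ = contradiction refl s≢□
read≢□⇒< (_ ∷ t) zero    s≢□ = s≤s z≤n
read≢□⇒< (_ ∷ t) (suc n) s≢□ = s≤s (read≢□⇒< t n s≢□)

length-write : {A : Set} (t : Tape A) {n : ℕ} {s : Symbol A} → n ℕ.< length t →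
               length (write t n s) ≡ length t
length-write (_ ∷ t) {zero}  _         = refl
length-write (_ ∷ t) {suc n} (s≤s n<) = cong suc (length-write t n<)

-- Inductive step of the time bound: a nonblank cell lies in the stored prefix, so overwriting it
-- keeps the length, and moving right uses up one remaining cell.
advance : {A : Set} (t : Tape A) {h k : ℕ} {s : Symbol A} → read t h ≢ □ →
          k ℕ.≤ suc (length (write t h s) ℕ.∸ suc h) → suc k ℕ.≤ suc (length t ℕ.∸ h)
advance t {h} {k} {s} s≢□ k≤ = s≤s (begin
  k                                       ≤⟨ k≤ ⟩
  suc (length (write t h s) ℕ.∸ suc h)    ≡⟨ cong (λ l → suc (l ℕ.∸ suc h)) (length-write t h<) ⟩
  suc (length t ℕ.∸ suc h)                ≡⟨ ℕ.+-∸-assoc 1 h< ⟨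
  length t ℕ.∸ h                          ∎)
  where
  open ℕ.≤-Reasoning
  h< : h ℕ.< length t
  h< = read≢□⇒< t h s≢□

act : Fin 2 → (work orcl : Γbin) → Move → NondetAction (Fin 2)
act s b o m = record
  { state = s ; workSymbol = b ; orclSymbol = o ; workMove = m ; orclMove = m }

guess : (b g : Bool) → NondetAction (Fin 2)
guess b g = act zero (val b) (val g) right

guesses : Bool → List (NondetAction (Fin 2))
guesses b = guess b true ∷ guess b false ∷ []

∈guesses⇒guess : ∀ {a b} → a ∈ˡ guesses b → ∃[ g ] a ≡ guess b g
∈guesses⇒guess (here refl)         = true , refl
∈guesses⇒guess (there (here refl)) = false , refl

guess∈guesses : ∀ {b} g → guess b g ∈ˡ guesses b
guess∈guesses true  = here refl
guess∈guesses false = there (here refl)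

-- Copies the shape of the input onto the oracle tape with guessed bits, both heads moving together.
-- At the first blank it accepts if the guessed word is in the oracle and is stuck otherwise.
guesser : NondetMachine
guesser = record { lastState = 1 ; δ = δ }
  where
  δ : Fin 2 → (work orcl : Γbin) → Bool → List (NondetAction (Fin 2))
  δ zero ▷       _ _    = act zero ▷ ▷ right ∷ []
  δ zero (val b) _ _    = guesses b
  δ zero □       _ true = act (suc zero) □ □ stay ∷ []
  δ _    _       _ _    = []

open module Guesser = NondetMachine guesser using (⟨_,_,_,_,_⟩)

module _ (o : Word → Bool) where
  open Guesser using (Run; done; _∷_; step; Config; accept; Accepts)

  private
    O : Oracle
    O = asOracle o

  answer : ∀ y → Answer O y (o y)
  answer y with o y in eq
  ... | true  = eq
  ... | false = λ y∈ → contradiction (trans (sym eq) y∈) λ ()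

  accepted⇒0 : ∀ {k c c′} → Config.state c ≡ accept → Run O k c c′ → k ≡ 0
  accepted⇒0 _        done                   = refl
  accepted⇒0 accepted (step running _ _ ∷ _) = contradiction accepted running

  -- The distance from the head to the end of the stored tape decreases with each move; the
  -- additional unit pays for the accepting step.
  guesser-run-bound : ∀ {t h u i k c} → Run O k ⟨ zero , t , h , u , i ⟩ c →
                      k ℕ.≤ suc (length t ℕ.∸ h)
  guesser-run-bound done = z≤n
  guesser-run-bound {t} {h} (step {r} _ _ a∈ ∷ run) with read t h in eq | r | a∈
  ... | □     | true | here refl         = s≤s (subst (ℕ._≤ _) (sym (accepted⇒0 refl run)) z≤n)
  ... | ▷     | _    | here refl         =
    advance t (subst (_≢ □) (sym eq) λ ()) (guesser-run-bound run)
  ... | val _ | _    | here refl         =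
    advance t (subst (_≢ □) (sym eq) λ ()) (guesser-run-bound run)
  ... | val _ | _    | there (here refl) =
    advance t (subst (_≢ □) (sym eq) λ ()) (guesser-run-bound run)

  -- The loop invariant: s is the part of the work tape already passed, v the unread input, u the
  -- oracle tape written so far.
  guessing : Tape Bool → Word → Tape Bool → Config
  guessing s v u = ⟨ zero , s ++ map val v , length s , u , length u ⟩

  guessing-∷ : ∀ s b v u g → Guesser.after (guessing s (b ∷ v) u) (guess b g)
                             ≡ guessing (s ++ val b ∷ []) v (u ++ val g ∷ [])
  guessing-∷ s b v u g
    rewrite write-length s {val b} {val b} {map val v} | write-end u {val g}
          | length-∷ʳ s {val b} | length-∷ʳ u {val g} = refl

  read-[] : (s : Tape Bool) → read (s ++ map val []) (length s) ≡ □
  read-[] s = trans (cong (λ t → read t (length s)) (List.++-identityʳ s)) (read-end s)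

  -- Induction on the unread input; y collects the bits still to be guessed, which will follow those
  -- on u.
  accepting⇒member : ∀ {k c} s v u → Run O k (guessing s v u) c → Config.state c ≡ accept →
                     ∃[ y ] length y ≡ length v × contents u ++ y ∈ O
  accepting⇒member s v       u done ()
  accepting⇒member s []      u (step {r} _ ans a∈ ∷ run) accepted
    with read (s ++ []) (length s) | read-[] s | r | a∈
  ... | _ | refl | true | here refl =
    [] , refl , trans (cong o (List.++-identityʳ (contents u))) ans
  accepting⇒member {c = c} s (b ∷ v) u (_∷_ {k = k} (step _ _ a∈) run) accepted
    with read (s ++ val b ∷ map val v) (length s) | read-length s {val b} {map val v}
  ... | _ | refl with ∈guesses⇒guess a∈
  ... | g , refl =
    let y , eq , y∈ = accepting⇒member (s ++ val b ∷ []) v (u ++ val g ∷ [])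
                        (subst (λ c′ → Run O k c′ c) (guessing-∷ s b v u g) run) accepted
    in g ∷ y , cong suc eq , subst (_∈ O) (contents-∷ʳ u y) y∈

  member⇒accepting : ∀ s v u y → length y ≡ length v → contents u ++ y ∈ O →
                     ∃[ k ] ∃[ c ] Run O k (guessing s v u) c × Config.state c ≡ accept
  member⇒accepting s []      u []      _  y∈ =
    1 , _ , step (λ ()) (trans (cong o (sym (List.++-identityʳ (contents u)))) y∈) a∈ ∷ done , refl
    where
    a∈ : act (suc zero) □ □ stay ∈ˡ
         NondetMachine.δ guesser zero (read (s ++ []) (length s)) (read u (length u)) true
    a∈ rewrite read-[] s = here refl
  member⇒accepting s (b ∷ v) u (g ∷ y) eq y∈ =
    let k , c , run , accepted =
          member⇒accepting (s ++ val b ∷ []) v (u ++ val g ∷ []) y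
            (ℕ.suc-injective eq) (subst (_∈ O) (sym (contents-∷ʳ u y)) y∈)
    in suc k , c ,
       step (λ ()) (answer (contents u)) a∈
         ∷ subst (λ c′ → Run O k c′ c) (sym (guessing-∷ s b v u g)) run ,
       accepted
    where
    a∈ : guess b g ∈ˡ NondetMachine.δ guesser zero
           (read (s ++ val b ∷ map val v) (length s)) (read u (length u)) (o (contents u))
    a∈ rewrite read-length s {val b} {map val v} = guess∈guesses g

  accepts⇔member : ∀ w → Accepts O w ⇔ (∃[ y ] length y ≡ length w × y ∈ O)
  accepts⇔member w = mk⇔
    (λ { (_ , _ , done , ())
       -- The first step carries both heads past `▷`, and from there on the invariant `guessing`
       -- holds.
       ; (_ , _ , step _ _ (here refl) ∷ run , accepted) →
           accepting⇒member (▷ ∷ []) w (▷ ∷ []) run accepted })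
    (λ (y , eq , y∈) →
      let k , c , run , accepted = member⇒accepting (▷ ∷ []) w (▷ ∷ []) y eq y∈
      in suc k , c , step {r = o []} (λ ()) (answer []) (here refl) ∷ run , accepted)

  guesser-NP : NP O (Accepts O)
  -- The polynomial n + 2: one step over `▷`, n guesses and one accepting step.
  guesser-NP = guesser , 2 ∷ 1 ∷ [] ,
    (λ w run → ℕ.≤-trans (guesser-run-bound run) (ℕ.≤-reflexive (bound w))) ,
    λ w → mk⇔ id id
    where
    bound : ∀ w → suc (length (startTape w)) ≡ eval (2 ∷ 1 ∷ []) (length w)
    bound w rewrite List.length-map {A = Bool} {B = Γbin} val w
                  | ℕ.*-zeroʳ (length w) | ℕ.*-identityʳ (length w) = refl

-- The oracle

tails : Bool → List Word → List Word
tails b []                   = []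
tails b ([] ∷ ys)            = tails b ys
tails true  ((true ∷ y) ∷ ys)  = y ∷ tails true ys
tails false ((false ∷ y) ∷ ys) = y ∷ tails false ys
tails true  ((false ∷ y) ∷ ys) = tails true ys
tails false ((true ∷ y) ∷ ys)  = tails false ys

∈tails : ∀ {b y ys} → b ∷ y ∈ˡ ys → y ∈ˡ tails b ys
∈tails {true}  {ys = _ ∷ _}            (here refl) = here refl
∈tails {false} {ys = _ ∷ _}            (here refl) = here refl
∈tails {b}     {ys = [] ∷ _}           (there y∈)  = ∈tails y∈
∈tails {true}  {ys = (true ∷ _) ∷ _}   (there y∈)  = there (∈tails y∈)
∈tails {true}  {ys = (false ∷ _) ∷ _}  (there y∈)  = ∈tails y∈
∈tails {false} {ys = (true ∷ _) ∷ _}   (there y∈)  = ∈tails y∈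
∈tails {false} {ys = (false ∷ _) ∷ _}  (there y∈)  = there (∈tails y∈)

length-tails : ∀ ys → length (tails true ys) ℕ.+ length (tails false ys) ℕ.≤ length ys
length-tails []                 = z≤n
length-tails ([] ∷ ys)          = ℕ.m≤n⇒m≤1+n (length-tails ys)
length-tails ((true ∷ _) ∷ ys)  = s≤s (length-tails ys)
length-tails ((false ∷ _) ∷ ys) =
  subst (ℕ._≤ suc (length ys)) (sym (ℕ.+-suc (length (tails true ys)) _)) (s≤s (length-tails ys))

-- Pigeonhole by descent in the binary tree: the words starting with `true` and those starting with
-- `false` cannot both number 2^n or more, so one branch is again too small to be full.
missing : ∀ n (ys : List Word) → length ys ℕ.< 2 ℕ.^ n → ∃[ y ] length y ≡ n × y ∉ˡ ys
missing zero    []       _        = [] , refl , λ ()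
missing zero    (_ ∷ _)  (s≤s ())
missing (suc n) ys       ys<      with length (tails true ys) ℕ.<? 2 ℕ.^ n
... | yes true< =
  let y , eq , y∉ = missing n (tails true ys) true<
  in true ∷ y , cong suc eq , y∉ ∘ ∈tails
... | no true≮ =
  let y , eq , y∉ = missing n (tails false ys) (ℕ.+-cancelˡ-< (2 ℕ.^ n) _ _ (begin-strict
        2 ℕ.^ n ℕ.+ length (tails false ys)                  ≤⟨ ℕ.+-monoˡ-≤ _ (ℕ.≮⇒≥ true≮) ⟩
        length (tails true ys) ℕ.+ length (tails false ys)   ≤⟨ length-tails ys ⟩
        length ys                                            <⟨ ys< ⟩
        2 ℕ.^ suc n                                          ≡⟨ cong (2 ℕ.^ n ℕ.+_) (ℕ.+-identityʳ (2 ℕ.^ n)) ⟩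
        2 ℕ.^ n ℕ.+ 2 ℕ.^ n                                  ∎))
  in false ∷ y , cong suc eq , y∉ ∘ ∈tails
  where open ℕ.≤-Reasoning

-- One step less than there are words of the stage length: some such word remains unqueried, while
-- every polynomial bound is eventually met.
stageLength stageTime : ℕ → ℕ
stageLength k = tower (suc k)
stageTime k   = pred (2 ℕ.^ stageLength k)

1+stageTime : ∀ k → suc (stageTime k) ≡ 2 ℕ.^ stageLength k
1+stageTime k = ℕ.suc-pred _ {{ℕ.m^n≢0 2 (stageLength k)}}

stageInput : ℕ → Word
stageInput k = replicate (stageLength k) true

stageOutput : ∃[ q ] Transition q → (Word → Bool) → ℕ → List ℚ
stageOutput (q , δ) o k = outputℚ (runℚ δ o (stageTime k) (initialℚ (stageInput k)))

stageQueries : ∃[ q ] Transition q → (Word → Bool) → ℕ → List Word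
stageQueries (q , δ) o k = queriesℚ δ o (stageTime k) (initialℚ (stageInput k))

∨-does⇒⊎ : {A : Set} (b : Bool) (a? : Dec A) → b ∨ does a? ≡ true → b ≡ true ⊎ A
∨-does⇒⊎ true  _       _ = inj₁ refl
∨-does⇒⊎ false (yes a) _ = inj₂ a

-- Diagonal construction over an enumeration with recurrence

module Diagonal
  (nth : ℕ → ∃[ q ] Transition q)
  (nth-recurs : ∀ {q} (δ : Transition q) l →
                ∃[ k ] l ℕ.≤ k × ∃[ δ′ ] nth k ≡ (q , δ′) × δ′ ≗δ δ)
  where

  -- Admitting every unqueried word, rather than a chosen one, makes membership decidable word by
  -- word.
  Fresh : ℕ → (Word → Bool) → Word → Set
  Fresh k o y = length y ≡ stageLength k
              × stageOutput (nth k) o k ≢ 1ℚ ∷ []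
              × y ∉ˡ stageQueries (nth k) o k

  fresh? : ∀ k o y → Dec (Fresh k o y)
  fresh? k o y = (length y ℕ.≟ stageLength k)
           ×-dec ¬? (List.≡-dec ℚ._≟_ _ _)
           ×-dec (y ∉? stageQueries (nth k) o k)
    where open DecMembership (List.≡-dec Bool._≟_) using (_∉?_)

  before : ℕ → Word → Bool
  before zero    y = false
  before (suc k) y = before k y ∨ does (fresh? k (before k) y)

  before-cases : ∀ k {y} → before (suc k) y ≡ true → before k y ≡ true ⊎ Fresh k (before k) y
  before-cases k {y} = ∨-does⇒⊎ (before k y) (fresh? k (before k) y)

  -- Earlier stages thus contribute only words shorter than `stageLength k`, which is `2 ^ tower k`.
  before⇒length≤ : ∀ k {y} → before k y ≡ true → length y ℕ.≤ tower k
  before⇒length≤ (suc k) y∈ with before-cases k y∈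
  ... | inj₁ y∈′        = ℕ.≤-trans (before⇒length≤ k y∈′) (tower-mono-≤ (ℕ.n≤1+n k))
  ... | inj₂ (len , _) = ℕ.≤-reflexive len

  before-suc : ∀ k {y} → ¬ Fresh k (before k) y → before (suc k) y ≡ before k y
  before-suc k {y} stale =
    trans (cong (before k y ∨_) (dec-false (fresh? k (before k) y) stale)) (Bool.∨-identityʳ _)

  -- Every stage from i on adds only words of length at least `tower (suc i)`.
  before-stable : ∀ {i j y} → length y ℕ.< tower (suc i) → i ℕ.≤ j → before j y ≡ before i y
  before-stable {i} {y = y} y< i≤j = stable (ℕ.≤⇒≤′ i≤j)
    where
    stable : ∀ {j} → i ℕ.≤′ j → before j y ≡ before i y
    stable ℕ.≤′-refl                = refl
    stable (ℕ.≤′-step {j} i≤′j) = trans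
      (before-suc j λ (len , _) → ℕ.<⇒≱ y<
        (ℕ.≤-trans (tower-mono-≤ (s≤s (ℕ.≤′⇒≤ i≤′j))) (ℕ.≤-reflexive (sym len))))
      (stable i≤′j)

  -- The limit of the stages: membership of y is settled by stage `length y`, as towers outgrow
  -- their index.
  diagonal : Word → Bool
  diagonal y = before (length y) y

  diagonal≡before : ∀ k {y} → length y ℕ.< tower (suc k) → diagonal y ≡ before k y
  diagonal≡before k {y} y< with ℕ.≤-total k (length y)
  ... | inj₁ k≤l = before-stable y< k≤l
  ... | inj₂ l≤k = sym (before-stable
    (ℕ.<-≤-trans (k<tower (length y)) (tower-mono-≤ (ℕ.n≤1+n (length y)))) l≤k)

  -- Stage k leaves out the words queried there, and these are too short to be added by any later
  -- stage.
  diagonal≡before-on-queries : ∀ k {y} → y ∈ˡ stageQueries (nth k) (before k) k →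
                               before k y ≡ diagonal y
  diagonal≡before-on-queries k {y} y∈ = sym (trans
    (diagonal≡before (suc k) (begin-strict
      length y                 <⟨ ∈queriesℚ⇒length< _ (before k) (stageTime k) _ y∈ ⟩
      stageTime k              <⟨ ℕ.n<1+n _ ⟩
      suc (stageTime k)        ≡⟨ 1+stageTime k ⟩
      2 ℕ.^ stageLength k      ∎))
    (before-suc k λ (_ , _ , y∉) → y∉ y∈))
    where open ℕ.≤-Reasoning

  stageOutput-diagonal : ∀ k →
    stageOutput (nth k) (before k) k ≡ stageOutput (nth k) diagonal k
  stageOutput-diagonal k = cong outputℚ
    (runℚ-cong (stageTime k) _ (λ _ _ _ _ → refl) (diagonal≡before-on-queries k))

  diagonal-defeats : ∀ k →
    ¬ (stageOutput (nth k) diagonal k ≡ 1ℚ ∷ [] ⇔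
       (∃[ y ] length y ≡ stageLength k × diagonal y ≡ true))
  diagonal-defeats k claim = rejects accepts
    where
    open Equivalence claim
    diagonal≡ : ∀ {y} → length y ≡ stageLength k → diagonal y ≡ before (suc k) y
    diagonal≡ len = diagonal≡before (suc k)
      (subst (ℕ._< tower (suc (suc k))) (sym len) (n<2^n (stageLength k)))
    rejects : stageOutput (nth k) diagonal k ≢ 1ℚ ∷ []
    rejects out≡1 with to out≡1
    ... | y , len , y∈ with before-cases k {y} (trans (sym (diagonal≡ {y} len)) y∈)
    -- A word from an earlier stage is too short to have the length of stage k.
    ... | inj₁ y∈′             = ℕ.<⇒≱ (n<2^n (tower k))
        (subst (ℕ._≤ tower k) len (before⇒length≤ k {y} y∈′))
    -- A word added at stage k presupposes that the run did not output 1, and that run is the same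
    -- with the final oracle.
    ... | inj₂ (_ , out≢1 , _) = out≢1 (trans (stageOutput-diagonal k) out≡1)
    accepts : stageOutput (nth k) diagonal k ≡ 1ℚ ∷ []
    accepts =
      let queries      = stageQueries (nth k) (before k) k
          -- Since the output is not 1, this unqueried word does enter the oracle, and `claim` then
          -- forces the output 1.
          y , len , y∉ = missing (stageLength k) queries (ℕ.≤-reflexive (trans
            (cong suc (length-queriesℚ _ (before k) (stageTime k) _)) (1+stageTime k)))
          fresh        = len , rejects ∘ trans (sym (stageOutput-diagonal k)) , y∉
      in from (y , len , trans (diagonal≡ {y} len) (trans
           (cong (before k y ∨_) (dec-true (fresh? k (before k) y) fresh)) (Bool.∨-zeroʳ _)))

  undecided : ¬ Pℝ (asOracle diagonal) (NondetMachine.Accepts guesser (asOracle diagonal))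
  undecided (M , p , decides)
    with eval-2^-subexponential p
  ... | l , p<2^
    with nth-recurs (RealMachine.δ M) l
  ... | k , l≤k , δ , k↦δ , δ≗ with decides (stageInput k)
  ... | c , halts , w∈⇔ = diagonal-defeats k
    (subst₂ (λ out n → out ≡ 1ℚ ∷ [] ⇔ (∃[ y ] length y ≡ n × diagonal y ≡ true))
      same-output (List.length-replicate (stageLength k))
      (accepts⇔member diagonal (stageInput k) ⇔-∘
        (⇔-sym w∈⇔ ⇔-∘ ⇔-sym (outputsOne⇔ M diagonal halts in-time))))
    where
    in-time : eval p (length (stageInput k)) ℕ.≤ stageTime k
    in-time rewrite List.length-replicate (stageLength k) {true} =
      -- The input length is 2^m with m = `tower k`, and l ≤ k ≤ `tower k` puts m above the
      -- threshold of the growth estimate.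
      ℕ.<⇒≤pred (p<2^ (ℕ.≤-trans l≤k (ℕ.<⇒≤ (k<tower k))))
    same-output : stageOutput (_ , RealMachine.δ M) diagonal k
                  ≡ stageOutput (nth k) diagonal k
    same-output = trans
      (cong outputℚ (runℚ-cong (stageTime k) _ (λ s b σ r → sym (δ≗ s b σ r)) (λ _ → refl)))
      (cong (λ t → stageOutput t diagonal k) (sym k↦δ))

corollary3 : ∃[ O ] NP O ⊈ Pℝ O
corollary3 = asOracle diagonal , λ NP⊆Pℝ → undecided (NP⊆Pℝ (guesser-NP diagonal))
  where open Diagonal nthTransition nthTransition-recurs using (diagonal; undecided)
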